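{- Let $i\ge 3$ and $k\ge 3$ be integers. Then: (a) $g_2(L_i,L_{i+2},L_{i+k})=(3L_i-1)L_{i+2}-L_i$ whenever $k\ge i+4$; (b) $g_2(L_i,L_{i+2},L_{2i+3})=(L_i-1)L_{i+2}+L_{2i+3}-L_i$; (c) $g_2(L_i,L_{i+2},L_{2i+2})=(L_i-1)L_{i+2}+L_{2i+2}-L_i$ if $i$ is odd, and $g_2(L_i,L_{i+2},L_{2i+2})=(2L_i-1)L_{i+2}-L_i$ if $i$ is even; (d) $g_2(L_i,L_{i+2},L_{2i+1})=(2F_{i-1}-1)L_{i+2}+2L_{2i+1}-L_i$; (e) $g_2(L_3,L_5,L_6)=L_5+3L_6-L_3=61$; (f) if $r=\lfloor (L_i-1)/F_k\rfloor\ge 2$ (which holds exactly when $k\le i$ and $(i,k)\ne(3,3)$), then $$g_2(L_i,L_{i+2},L_{i+k})=\begin{cases}(L_i-rF_k-1)L_{i+2}+(r+2)L_{i+k}-L_i & \text{if } (L_i-rF_k)L_{i+2}\ge F_{k-2}L_i,\\ (F_k-1)L_{i+2}+(r+1)L_{i+k}-L_i & \text{if } (L_i-rF_k)L_{i+2}< F_{k-2}L_i.\end{cases}$$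
   Context: Fibonacci numbers: $F_0=0$, $F_1=1$, $F_n=F_{n-1}+F_{n-2}$. Lucas numbers: $L_0=2$, $L_1=1$, $L_n=L_{n-1}+L_{n-2}$. For positive integers $a_1,\dots,a_l$ with $\gcd(a_1,\dots,a_l)=1$ and an integer $n$, let $d(n;a_1,\dots,a_l)$ be the number of tuples $(x_1,\dots,x_l)$ of nonnegative integers with $a_1x_1+\dots+a_lx_l=n$. For a nonnegative integer $p$, the $p$-Frobenius number $g_p(a_1,\dots,a_l)$ is the largest integer $n$ with $d(n;a_1,\dots,a_l)\le p$. -}

module Defs where

open import Data.Empty using (⊥-elim)
open import Data.Fin using (Fin; zero; suc)
open import Data.Integer as ℤ using (ℤ; +_; ∣_∣)
import Data.Integer.Properties as ℤ
open import Data.List as List using (List; []; _∷_)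
open import Data.List.Membership.Propositional using (_∈_)
open import Data.List.Membership.Propositional.Properties
open import Data.List.Relation.Unary.All as ListAll using ()
open import Data.List.Relation.Unary.AllPairs using ([]; _∷_)
open import Data.List.Relation.Unary.Any using (here; index)
open import Data.List.Relation.Unary.Any.Properties using (lookup-index)
open import Data.List.Relation.Unary.Unique.Propositional using (Unique)
import Data.List.Relation.Unary.Unique.Propositional.Properties as Unique
open import Data.Nat
open import Data.Nat.GCD using (gcd)
open import Data.Nat.Properties
open import Data.Product using (Σ-syntax; _,_; proj₁; proj₂)
open import Data.Vec as Vec using (Vec; []; _∷_)
open import Data.Vec.Properties using (∷-injective)
open import Data.Vec.Relation.Unary.All using (All; []; _∷_)
open import Axiom.UniquenessOfIdentityProofs using (module Decidable⇒UIP)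
open import Function.Bundles using (_↔_; mk↔ₛ′)
open import Relation.Binary.PropositionalEquality

private
  variable
    l : ℕ

F : ℕ → ℕ
F zero          = 0
F (suc zero)    = 1
F (suc (suc n)) = F (suc n) + F n

L : ℕ → ℕ
L zero          = 2
L (suc zero)    = 1
L (suc (suc n)) = L (suc n) + L n

F-nonZero : ∀ {k} → 3 ≤ k → NonZero (F k)
F-nonZero {k} 3≤k = >-nonZero (F-pos k (≤-trans (s≤s z≤n) 3≤k))
  where
  F-pos : ∀ n → 1 ≤ n → 1 ≤ F n
  F-pos (suc zero)    _ = ≤-refl
  F-pos (suc (suc n)) _ = ≤-trans (F-pos (suc n) (s≤s z≤n)) (m≤m+n _ (F n))

dot : Vec ℕ l → Vec ℕ l → ℕ
dot []       []       = 0
dot (a ∷ as) (x ∷ xs) = a * x + dot as xs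

Solution : ℤ → Vec ℕ l → Set
Solution {l} n as = Σ[ xs ∈ Vec ℕ l ] + dot as xs ≡ n

box : ℕ → (l : ℕ) → List (Vec ℕ l)
box b zero    = [] ∷ []
box b (suc l) = List.cartesianProductWith _∷_ (List.upTo (suc b)) (box b l)

-- When all aⱼ are positive, every solution has entries at most ∣ n ∣, so
-- searching the box misses none: see d-correct.
solutions : ℤ → Vec ℕ l → List (Vec ℕ l)
solutions {l} n as = List.filter (λ xs → + dot as xs ℤ.≟ n) (box ∣ n ∣ l)

d : ℤ → Vec ℕ l → ℕ
d n as = List.length (solutions n as)

-- The standing assumptions on the generators are part of the relation:
-- with a zero generator d would not count solutions.
record IsFrobenius (p : ℕ) (as : Vec ℕ l) (g : ℤ) : Set where
  field
    positive : All NonZero as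
    coprime  : Vec.foldr′ gcd 0 as ≡ 1
    d≤p      : d g as ≤ p
    greatest : ∀ n → d n as ≤ p → n ℤ.≤ g

private
  box-unique : ∀ b l → Unique (box b l)
  box-unique b zero    = ListAll.[] ∷ []
  box-unique b (suc l) =
    Unique.cartesianProductWith⁺ _∷_ ∷-injective
      (Unique.upTo⁺ (suc b)) (box-unique b l)

  ∈-box : ∀ b {as : Vec ℕ l} → All NonZero as →
          ∀ xs → dot as xs ≤ b → xs ∈ box b l
  ∈-box b []                 []       _  = here refl
  ∈-box b (_∷_ {x = a} a≢0 nz) (x ∷ xs) le =
    ∈-cartesianProductWith⁺ _∷_
      (∈-upTo⁺ (s≤s (≤-trans (m≤n*m x a {{a≢0}}) (m+n≤o⇒m≤o (a * x) le))))
      (∈-box b nz xs (m+n≤o⇒n≤o (a * x) le))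

  lookup-injective : ∀ {A : Set} {xs : List A} → Unique xs →
                     ∀ i j → List.lookup xs i ≡ List.lookup xs j → i ≡ j
  lookup-injective (_ ∷ _)  zero    zero    _  = refl
  lookup-injective (x∉ ∷ _) zero    (suc j) eq =
    ⊥-elim (ListAll.lookup x∉ (∈-lookup j) eq)
  lookup-injective (x∉ ∷ _) (suc i) zero    eq =
    ⊥-elim (ListAll.lookup x∉ (∈-lookup i) (sym eq))
  lookup-injective (_ ∷ u)  (suc i) (suc j) eq =
    cong suc (lookup-injective u i j eq)

  Solution-≡ : ∀ {n} {as : Vec ℕ l} {s t : Solution n as} →
               proj₁ s ≡ proj₁ t → s ≡ t
  Solution-≡ {s = xs , p} {t = .xs , q} refl = cong (xs ,_) (Decidable⇒UIP.≡-irrelevant ℤ._≟_ p q)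

d-correct : ∀ n {as : Vec ℕ l} → All NonZero as → Fin (d n as) ↔ Solution n as
d-correct {l} n {as} nz = mk↔ₛ′ to from to∘from from∘to
  where
  P? = λ (xs : Vec ℕ l) → + dot as xs ℤ.≟ n

  to : Fin (d n as) → Solution n as
  to j = List.lookup (solutions n as) j
       , proj₂ (∈-filter⁻ P? {xs = box ∣ n ∣ l} (∈-lookup j))

  mem : (s : Solution n as) → proj₁ s ∈ solutions n as
  mem (xs , p) = ∈-filter⁺ P? (∈-box ∣ n ∣ nz xs (≤-reflexive (cong ∣_∣ p))) p

  from : Solution n as → Fin (d n as)
  from s = index (mem s)

  to∘from : ∀ s → to (from s) ≡ s
  to∘from s = Solution-≡ {as = as} (sym (lookup-index (mem s)))

  from∘to : ∀ j → from (to j) ≡ j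
  from∘to j = lookup-injective (Unique.filter⁺ P? (box-unique ∣ n ∣ l)) _ _
                (sym (lookup-index (mem (to j))))

{-# OPTIONS --safe #-}
-- Put a = L i, b = L (i + 2), c = L (i + k), q = F k, s = F (k − 2), so that
-- c + s a = q b, and write g + a = M = b Y + c Z for the claimed value g.
--
-- A class modulo a is that of b j for one j < a, and b y + c z lies in it
-- exactly when y + q z ≡ j.  So every n > g has three representations as soon as every
-- class contains three pairs (y , z) with b y + c z ≤ M.
--
-- Conversely a (x + 1) + b y + c z = M holds exactly when, for some integer t,
--   y + q z + a t = Y + q Z   and   x + 1 + s Z = b t + s z.
-- As 2a ≤ b and 2s ≤ q, Y ≤ 3a rules out t < 0, while t = 0 forces z > Z; in
-- each case at most two (t , z) satisfy a t + q z ≤ Y + q Z and this constraint.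
module Submission where

open import Defs

-- Fibonacci and Lucas numbers matter only through the fields of `Generators` and through the size
-- of `q` against `a`, and that size gives the theorem its cases: `3 a ≤ q` in (a), `a ≤ q ≤ 2 a` in
-- (b) and (c), `q + s = a` in (d), `2 q ≤ a` in (e) and (f). The obstacle is that a `c` is not
-- worth exactly `q` copies of `b`: it falls short by `s a`. Points of one class with equal
-- `y + q z` therefore have different values, and the worst class depends on comparisons such as `c`
-- with `a b`, or `e b` with `s a` where `a = r q + e`. These comparisons are the subcases of (c)
-- and (f). The shift from `g` to `M = g + a` absorbs the coordinate `x`: a value in the class of
-- `n` that is less than `n + a` is already at most `n`, so `n > g` needs only points of value at
-- most `M`. Congruences carry natural multipliers on both sides, so that integers appear only in
-- the final formulas.

module Naturals where
  open import Axiom.UniquenessOfIdentityProofs using (module Decidable⇒UIP)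
  open import Data.Fin using (Fin; zero; suc)
  open import Data.Fin.Properties using (injective⇒≤)
  open import Data.Integer as ℤ using (ℤ; +_; -[1+_])
  import Data.Integer.Properties as ℤ
  open import Data.List using ([]; _∷_)
  open import Data.Nat
  open import Data.Nat.Coprimality using (Coprime; coprime-divisor; coprime-Bézout; coprime⇒gcd≡1)
  open import Data.Nat.Divisibility
  open import Data.Nat.DivMod
  open import Data.Nat.GCD using (gcd; gcd-assoc; gcd-zeroˡ; module Bézout)
  open import Data.Nat.Properties
  open import Data.Nat.Tactic.RingSolver using (solve; solve-∀)
  open import Data.Product using (∃; ∃-syntax; _×_; _,_; proj₁; proj₂)
  open import Data.Sum using (_⊎_; inj₁; inj₂)
  open import Data.Vec as Vec using (Vec)
  import Data.Vec.Relation.Unary.All as All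
  open import Function.Base using (_∘_)
  open import Function.Bundles using (module Inverse; _⇔_; mk⇔)
  open import Relation.Binary.PropositionalEquality
  open import Relation.Nullary using (¬_; yes; no; contradiction)
  open import Relation.Nullary.Decidable using (decidable-stable)

  -- Abstract generators, and at most two representations of g

  ≤-by : ∀ {m n} o → m + o ≡ n → m ≤ n
  ≤-by o eq = m+n≤o⇒m≤o _ (≤-reflexive eq)

  Solution-≡ : ∀ {l n} {as : Vec ℕ l} {s t : Solution n as} → proj₁ s ≡ proj₁ t → s ≡ t
  Solution-≡ {s = xs , p} {t = .xs , q} refl = cong (xs ,_) (Decidable⇒UIP.≡-irrelevant ℤ._≟_ p q)

  record Generators (a b c q s : ℕ) : Set where
    field
      1≤a     : 1 ≤ a
      1≤s     : 1 ≤ s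
      2a≤b    : 2 * a ≤ b
      2s≤q    : 2 * s ≤ q
      coprime : Coprime a b
      c+sa≡qb : c + s * a ≡ q * b

  -- `B` will be `suc (Y + q * Z)`, so the strict bound leaves room for some `y ≥ 0`. Neither `y`
  -- nor `x` occurs, because `(t , z)` determines both.
  AtMostTwo : (a q B Z : ℕ) → (p p′ : ℕ × ℕ) → Set
  AtMostTwo a q B Z p p′ = ∀ t z → a * t + q * z < B → (t ≡ 0 → Z < z) → (t , z) ≡ p ⊎ (t , z) ≡ p′

  module _ {a b c q s : ℕ} (G : Generators a b c q s) where
    open Generators G

    private instance
      a≢0 : NonZero a
      a≢0 = >-nonZero 1≤a
      b≢0 : NonZero b
      b≢0 = >-nonZero (≤-trans 1≤a (m+n≤o⇒m≤o a 2a≤b))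

    1≤q : 1 ≤ q
    1≤q = ≤-trans 1≤s (m+n≤o⇒m≤o s 2s≤q)

    -- `q * b = c + s * a` has room for `(2 s) (2 a)`, four copies of `s * a`. This keeps the defect
    -- `s * a` of one `c` against `q` copies of `b` small compared with `c`.
    3sa≤c : 3 * (s * a) ≤ c
    3sa≤c = +-cancelʳ-≤ (s * a) _ _ (begin
      3 * (s * a) + s * a ≡⟨ solve (s ∷ a ∷ []) ⟩
      (2 * s) * (2 * a)   ≤⟨ *-mono-≤ 2s≤q 2a≤b ⟩
      q * b               ≡⟨ c+sa≡qb ⟨
      c + s * a           ∎)
      where open ≤-Reasoning

    a≤c : a ≤ c
    a≤c = begin
      a           ≤⟨ m≤n*m a s {{>-nonZero 1≤s}} ⟩
      s * a       ≤⟨ m≤m+n _ _ ⟩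
      3 * (s * a) ≤⟨ 3sa≤c ⟩
      c           ∎
      where open ≤-Reasoning

    private instance
      c≢0 : NonZero c
      c≢0 = >-nonZero (≤-trans 1≤a a≤c)

    -- Cancelling leaves `a p = a p′ + b D`, and coprimality makes `a` divide `D`; the quotient is
    -- `t`. The two branches of `slope` are then the two signs of the integer `t`.
    slope-≤ : ∀ {p p′ N} D → a * p + b * N ≡ b * (N + D) + a * p′ →
              ∃[ t ] N + D ≡ N + a * t × p ≡ b * t + p′
    slope-≤ {p} {p′} {N} D eq = from a∣D eq′
      where
      eq′ : a * p ≡ a * p′ + b * D
      eq′ = +-cancelʳ-≡ (b * N) _ _ (trans eq (solve (a ∷ b ∷ N ∷ D ∷ p′ ∷ [])))
      a∣D : a ∣ D
      a∣D = coprime-divisor coprime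
              (∣m+n∣m⇒∣n (subst (a ∣_) eq′ (m∣m*n p)) (m∣m*n p′))
      from : ∀ {D} → a ∣ D → a * p ≡ a * p′ + b * D → ∃[ t ] N + D ≡ N + a * t × p ≡ b * t + p′
      from (divides t refl) eq = t , cong (λ u → N + u) (*-comm t a) ,
        *-cancelˡ-≡ p (b * t + p′) a (trans eq (solve (a ∷ b ∷ t ∷ p′ ∷ [])))

    slope : ∀ {p p′} N N₀ → a * p + b * N ≡ b * N₀ + a * p′ →
            (∃[ t ] N₀ ≡ N + a * t × p ≡ b * t + p′) ⊎
            (∃[ t ] N ≡ N₀ + a * t × p′ ≡ b * t + p)
    slope {p} {p′} N N₀ eq with ≤-total N N₀
    ... | inj₁ N≤N₀ with D , refl ← m≤n⇒∃[o]m+o≡n N≤N₀ = inj₁ (slope-≤ D eq)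
    ... | inj₂ N₀≤N with D , refl ← m≤n⇒∃[o]m+o≡n N₀≤N =
      inj₂ (slope-≤ D (trans (+-comm (a * p′) _) (trans (sym eq) (+-comm (a * p) _))))

    solution-slope : ∀ {x y z} Y Z → Y ≤ 3 * a → a * suc x + (b * y + c * z) ≡ b * Y + c * Z →
                     ∃[ t ] a * t + q * z + y ≡ Y + q * Z × (t ≡ 0 → Z < z)
    solution-slope {x} {y} {z} Y Z Y≤3a eq = go (slope (y + q * z) (Y + q * Z) eq′)
      where
      -- Adding `a (s Z + s z)` to both sides completes every `c` to `q b`, which leaves an equation
      -- in `a` and `b` alone.
      eq′ : a * (suc x + s * Z) + b * (y + q * z) ≡ b * (Y + q * Z) + a * (s * z)
      eq′ = begin
        a * (suc x + s * Z) + b * (y + q * z)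
          ≡⟨ expand (suc x) ⟩
        a * suc x + (b * y + z * (q * b)) + a * (s * Z)
          ≡⟨ cong (λ u → a * suc x + (b * y + z * u) + a * (s * Z)) c+sa≡qb ⟨
        a * suc x + (b * y + z * (c + s * a)) + a * (s * Z)
          ≡⟨ regroup (suc x) ⟩
        a * suc x + (b * y + c * z) + (a * (s * Z) + a * (s * z))
          ≡⟨ cong (_+ (a * (s * Z) + a * (s * z))) eq ⟩
        b * Y + c * Z + (a * (s * Z) + a * (s * z))
          ≡⟨ solve (a ∷ b ∷ c ∷ s ∷ Y ∷ Z ∷ z ∷ []) ⟩
        b * Y + Z * (c + s * a) + a * (s * z)
          ≡⟨ cong (λ u → b * Y + Z * u + a * (s * z)) c+sa≡qb ⟩
        b * Y + Z * (q * b) + a * (s * z)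
          ≡⟨ solve (a ∷ b ∷ q ∷ s ∷ Y ∷ Z ∷ z ∷ []) ⟩
        b * (Y + q * Z) + a * (s * z) ∎
        where
        open ≡-Reasoning
        expand : ∀ u → a * (u + s * Z) + b * (y + q * z) ≡ a * u + (b * y + z * (q * b)) + a * (s * Z)
        expand u = solve (a ∷ b ∷ q ∷ s ∷ y ∷ z ∷ Z ∷ u ∷ [])
        regroup : ∀ u → a * u + (b * y + z * (c + s * a)) + a * (s * Z) ≡
                        a * u + (b * y + c * z) + (a * (s * Z) + a * (s * z))
        regroup u = solve (a ∷ b ∷ c ∷ s ∷ y ∷ z ∷ Z ∷ u ∷ [])

      Z<z : suc x + s * Z ≤ s * z → Z < z
      Z<z le = *-cancelˡ-< s _ _ (≤-trans (s≤s (m≤n+m _ x)) le)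

      go : (∃[ t ] Y + q * Z ≡ y + q * z + a * t × suc x + s * Z ≡ b * t + s * z) ⊎
           (∃[ t ] y + q * z ≡ Y + q * Z + a * t × s * z ≡ b * t + (suc x + s * Z)) →
           ∃[ t ] a * t + q * z + y ≡ Y + q * Z × (t ≡ 0 → Z < z)
      go (inj₁ (t , N₀≡ , x≡)) =
        t , sym (trans N₀≡ (solve (a ∷ q ∷ t ∷ y ∷ z ∷ []))) ,
        λ { refl → Z<z (≤-reflexive (trans x≡ (cong (_+ s * z) (*-zeroʳ b)))) }
      -- The value `t = 0` can arrive through either branch of `slope`.
      go (inj₂ (zero , N≡ , x≡)) =
        0 , sym (trans (sym (trans N≡ (trans (cong (λ u → Y + q * Z + u) (*-zeroʳ a)) (+-identityʳ _))))
                  (solve (a ∷ q ∷ y ∷ z ∷ []))) ,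
        λ _ → Z<z (≤-trans (m≤n+m _ (b * 0)) (≤-reflexive (sym x≡)))
      go (inj₂ (t@(suc T) , N≡ , x≡)) = contradiction too-small (<-irrefl refl)
        where
        open ≤-Reasoning
        -- Taking `s` times one relation and `q` times the other eliminates `z`. What survives is
        -- `c t + q ≤ s Y`, against `s Y ≤ 3 s a ≤ c`.
        scaled : s * Y + (s * a * t + q * (s * Z)) ≥ q * b * t + (q + q * (s * Z))
        scaled = begin
          q * b * t + (q + q * (s * Z))         ≤⟨ ≤-by (q * x) (bound t) ⟩
          q * (b * t + (suc x + s * Z))         ≡⟨ cong (q *_) x≡ ⟨
          q * (s * z)                           ≤⟨ ≤-by (s * y) (solve (q ∷ s ∷ y ∷ z ∷ [])) ⟩
          s * (y + q * z)                       ≡⟨ cong (s *_) N≡ ⟩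
          s * (Y + q * Z + a * t)               ≡⟨ rearrange t ⟩
          s * Y + (s * a * t + q * (s * Z))     ∎
          where
          bound : ∀ t → q * b * t + (q + q * (s * Z)) + q * x ≡ q * (b * t + (1 + x + s * Z))
          bound t = solve (q ∷ b ∷ t ∷ s ∷ Z ∷ x ∷ [])
          rearrange : ∀ t → s * (Y + q * Z + a * t) ≡ s * Y + (s * a * t + q * (s * Z))
          rearrange t = solve (s ∷ Y ∷ q ∷ Z ∷ a ∷ t ∷ [])
        too-small : c * t < c * t
        too-small = +-cancelʳ-< (s * a * t + q * (s * Z)) _ _ (begin-strict
          c * t + (s * a * t + q * (s * Z))     ≡⟨ regroup t ⟩
          (c + s * a) * t + q * (s * Z)         ≡⟨ cong (λ u → u * t + q * (s * Z)) c+sa≡qb ⟩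
          q * b * t + q * (s * Z)               <⟨ +-monoʳ-< (q * b * t) (+-monoˡ-≤ (q * (s * Z)) 1≤q) ⟩
          q * b * t + (q + q * (s * Z))         ≤⟨ scaled ⟩
          s * Y + (s * a * t + q * (s * Z))     ≤⟨ +-monoˡ-≤ _ sY≤ct ⟩
          c * t + (s * a * t + q * (s * Z))     ∎)
          where
          regroup : ∀ t → c * t + (s * a * t + q * (s * Z)) ≡ (c + s * a) * t + q * (s * Z)
          regroup t = solve (c ∷ t ∷ s ∷ a ∷ q ∷ Z ∷ [])
          sY≤ct : s * Y ≤ c * t
          sY≤ct = begin
            s * Y       ≤⟨ *-monoʳ-≤ s Y≤3a ⟩
            s * (3 * a) ≡⟨ solve (s ∷ a ∷ []) ⟩
            3 * (s * a) ≤⟨ 3sa≤c ⟩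
            c           ≤⟨ m≤m*n c t ⟩
            c * t       ∎

    private
      gens : Vec ℕ 3
      gens = a Vec.∷ b Vec.∷ c Vec.∷ Vec.[]
      gens≢0 : All.All NonZero gens
      gens≢0 = a≢0 All.∷ b≢0 All.∷ c≢0 All.∷ All.[]

    -- Recording which of `p` and `p′` a solution yields is injective: `(t , z)` fixes `y` through
    -- the sum, and then the value of the form fixes `x`.
    d≤2 : ∀ {Y Z p p′} → Y ≤ 3 * a → AtMostTwo a q (suc (Y + q * Z)) Z p p′ →
          d (+ (b * Y + c * Z) ℤ.- + a) gens ≤ 2
    d≤2 {Y} {Z} {p} {p′} Y≤3a two = injective⇒≤ {f = proj₁ ∘ key ∘ to} λ {i} {j} eq → to-injective (key-injective eq)
      where
      n = + (b * Y + c * Z) ℤ.- + a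
      open Inverse (d-correct n gens≢0) using (to; from; strictlyInverseʳ)

      to-injective : ∀ {i j} → to i ≡ to j → i ≡ j
      to-injective {i} {j} eq = trans (sym (strictlyInverseʳ i)) (trans (cong from eq) (strictlyInverseʳ j))

      pick : Fin 2 → ℕ × ℕ
      pick zero    = p
      pick (suc _) = p′

      equation : ∀ {x y z} → + dot gens (x Vec.∷ y Vec.∷ z Vec.∷ Vec.[]) ≡ n → a * suc x + (b * y + c * z) ≡ b * Y + c * Z
      equation {x} {y} {z} eq = ℤ.+-injective (begin
        + (a * suc x + (b * y + c * z))      ≡⟨ cong +_ (solve (a ∷ b ∷ c ∷ x ∷ y ∷ z ∷ [])) ⟩
        + (a * x + (b * y + (c * z + 0)) + a) ≡⟨ ℤ.pos-+ _ a ⟩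
        + (a * x + (b * y + (c * z + 0))) ℤ.+ + a ≡⟨ cong (ℤ._+ + a) eq ⟩
        n ℤ.+ + a                             ≡⟨ ℤ.+-assoc (+ (b * Y + c * Z)) (ℤ.- + a) (+ a) ⟩
        + (b * Y + c * Z) ℤ.+ (ℤ.- + a ℤ.+ + a) ≡⟨ cong (λ u → + (b * Y + c * Z) ℤ.+ u) (ℤ.+-inverseˡ (+ a)) ⟩
        + (b * Y + c * Z) ℤ.+ + 0             ≡⟨ ℤ.+-identityʳ _ ⟩
        + (b * Y + c * Z)                     ∎)
        where open ≡-Reasoning

      Key : Vec ℕ 3 → Fin 2 → Set
      Key (x Vec.∷ y Vec.∷ z Vec.∷ Vec.[]) i = ∃[ t ] a * t + q * z + y ≡ Y + q * Z × (t , z) ≡ pick i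

      key : (σ : Solution n gens) → ∃ (Key (proj₁ σ))
      key (x Vec.∷ y Vec.∷ z Vec.∷ Vec.[] , eq) with solution-slope Y Z Y≤3a (equation eq)
      ... | t , sum , early with two t z (s≤s (≤-by y sum)) early
      ... | inj₁ tz≡p  = zero , t , sum , tz≡p
      ... | inj₂ tz≡p′ = suc zero , t , sum , tz≡p′

      same : ∀ xs xs′ {i} → Key xs i → Key xs′ i → dot gens xs ≡ dot gens xs′ → xs ≡ xs′
      same (x Vec.∷ y Vec.∷ z Vec.∷ Vec.[]) (x′ Vec.∷ y′ Vec.∷ z′ Vec.∷ Vec.[]) (t , sum , tz) (t′ , sum′ , tz′) eq
        with refl ← trans tz (sym tz′)
        with refl ← +-cancelˡ-≡ (a * t + q * z) y y′ (trans sum (sym sum′))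
        with refl ← *-cancelˡ-≡ x x′ a (+-cancelʳ-≡ _ (a * x) (a * x′) eq) = refl

      key-injective : ∀ {σ τ} → proj₁ (key σ) ≡ proj₁ (key τ) → σ ≡ τ
      key-injective {σ} {τ} eq = Solution-≡ {as = gens}
        (same (proj₁ σ) (proj₁ τ) (proj₂ (key σ)) (subst (Key (proj₁ τ)) (sym eq) (proj₂ (key τ)))
          (ℤ.+-injective (trans (proj₂ σ) (sym (proj₂ τ)))))

    -- Three representations of every larger integer

    residue : ∀ n → ∃[ j ] ∃[ u ] ∃[ v ] j < a × b * j + a * u ≡ n + a * v
    residue n = reduce (inverse (coprime-Bézout coprime))
      where
      inverse : Bézout.Identity 1 a b → ∃[ J ] ∃[ u ] ∃[ v ] b * J + a * u ≡ n + a * v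
      inverse (Bézout.-+ x y eq) = y * n , 0 , x * n , (begin
        b * (y * n) + a * 0 ≡⟨ solve (a ∷ b ∷ y ∷ n ∷ []) ⟩
        (y * b) * n         ≡⟨ cong (_* n) eq ⟨
        (1 + x * a) * n     ≡⟨ solve (x ∷ a ∷ n ∷ []) ⟩
        n + a * (x * n)     ∎)
        where open ≡-Reasoning
      -- Here `y b ≡ −1` modulo `a`, and the factor `a′ = a − 1 ≡ −1` corrects the sign.
      inverse (Bézout.+- x y eq) with a′ , 1+a′≡a ← m≤n⇒∃[o]m+o≡n 1≤a =
        a′ * (y * n) , n , a′ * (x * n) , (begin
        b * (a′ * (y * n)) + a * n                ≡⟨ cong (λ u → b * (a′ * (y * n)) + u * n) 1+a′≡a ⟨
        b * (a′ * (y * n)) + (1 + a′) * n         ≡⟨ solve (b ∷ a′ ∷ y ∷ n ∷ []) ⟩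
        n + a′ * n * (1 + y * b)                  ≡⟨ cong (λ u → n + a′ * n * u) eq ⟩
        n + a′ * n * (x * a)                      ≡⟨ solve (n ∷ a′ ∷ a ∷ x ∷ []) ⟩
        n + a * (a′ * (x * n))                    ∎)
        where open ≡-Reasoning

      reduce : (∃[ J ] ∃[ u ] ∃[ v ] b * J + a * u ≡ n + a * v) →
               ∃[ j ] ∃[ u ] ∃[ v ] j < a × b * j + a * u ≡ n + a * v
      reduce (J , u , v , eq) = J % a , b * (J / a) + u , v , m%n<n J a , trans (regroup (J % a) (J / a)) eq′
        where
        regroup : ∀ m o → b * m + a * (b * o + u) ≡ b * (m + o * a) + a * u
        regroup m o = solve (a ∷ b ∷ m ∷ o ∷ u ∷ [])
        eq′ : b * (J % a + J / a * a) + a * u ≡ n + a * v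
        eq′ = subst (λ J → b * J + a * u ≡ n + a * v) (m≡m%n+[m/n]*n J a) eq

    -- Numbers congruent modulo `a` differ by a multiple of `a`, so `V < n + a` already forces
    -- `V ≤ n`, and the quotient of the difference is `x`.
    complete : ∀ {V n} p p′ → V < n + a → V + a * p ≡ n + a * p′ → ∃[ x ] a * x + V ≡ n
    complete {V} {n} p p′ V<n+a eq with p′ ≤? p
    ... | yes p′≤p with x , refl ← m≤n⇒∃[o]m+o≡n p′≤p =
      x , +-cancelʳ-≡ (a * p′) _ _ (trans (regroup x) eq)
      where
      regroup : ∀ x → a * x + V + a * p′ ≡ V + a * (p′ + x)
      regroup x = solve (a ∷ x ∷ V ∷ p′ ∷ [])
    ... | no p′≰p = contradiction V<n+a (≤⇒≯ (+-cancelʳ-≤ (a * p) _ _ (begin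
      n + a + a * p   ≡⟨ solve (n ∷ a ∷ p ∷ []) ⟩
      n + a * suc p   ≤⟨ +-monoʳ-≤ n (*-monoʳ-≤ a (≰⇒> p′≰p)) ⟩
      n + a * p′      ≡⟨ eq ⟨
      V + a * p       ∎)))
      where open ≤-Reasoning

    record Reaches (M j y z : ℕ) : Set where
      constructor reaches
      field
        {w t}   : ℕ
        congruent : y + q * z + a * w ≡ j + a * t
        value≤M : b * y + c * z ≤ M

    -- By c ≡ q b (mod a), the pairs in the class of j are the (y , z) for which
    -- b y + c z is congruent to b j modulo a.
    data ThreeBelow (M j : ℕ) : Set where
      three : ∀ {y z y′ z′ y″ z″} →
              Reaches M j y z → Reaches M j y′ z′ → Reaches M j y″ z″ →
              (y , z) ≢ (y′ , z′) → (y , z) ≢ (y″ , z″) → (y′ , z′) ≢ (y″ , z″) →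
              ThreeBelow M j

    solution : ∀ {M j n u v y z} → M < n + a → b * j + a * u ≡ n + a * v → Reaches M j y z →
               ∃[ x ] + dot gens (x Vec.∷ y Vec.∷ z Vec.∷ Vec.[]) ≡ + n
    solution {M} {j} {n} {u} {v} {y} {z} M<n+a j≡n (reaches {w} {t} y≡j V≤M) =
      -- Completing each `c` to `q b` costs `s z` copies of `a`; multiplying the congruence of the
      -- pair by `b` turns its multipliers into `b w` and `b t`.
      let x , eq = complete (s * z + b * w + u) (v + b * t) (≤-<-trans V≤M M<n+a) eq′
      in x , cong +_ (trans (cong (λ V → a * x + (b * y + V)) (+-identityʳ (c * z))) eq)
      where
      open ≡-Reasoning
      eq′ : b * y + c * z + a * (s * z + b * w + u) ≡ n + a * (v + b * t)
      eq′ = begin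
        b * y + c * z + a * (s * z + b * w + u)             ≡⟨ solve (a ∷ b ∷ c ∷ s ∷ y ∷ z ∷ w ∷ u ∷ []) ⟩
        b * y + z * (c + s * a) + (a * (b * w) + a * u)     ≡⟨ cong (λ V → b * y + z * V + (a * (b * w) + a * u)) c+sa≡qb ⟩
        b * y + z * (q * b) + (a * (b * w) + a * u)         ≡⟨ solve (a ∷ b ∷ q ∷ y ∷ z ∷ w ∷ u ∷ []) ⟩
        b * (y + q * z + a * w) + a * u                     ≡⟨ cong (λ V → b * V + a * u) y≡j ⟩
        b * (j + a * t) + a * u                             ≡⟨ solve (a ∷ b ∷ j ∷ t ∷ u ∷ []) ⟩
        b * j + a * u + a * (b * t)                         ≡⟨ cong (_+ a * (b * t)) j≡n ⟩
        n + a * v + a * (b * t)                             ≡⟨ solve (n ∷ a ∷ v ∷ b ∷ t ∷ []) ⟩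
        n + a * (v + b * t)                                 ∎

    3≤d : ∀ {M n} → (∀ j → j < a → ThreeBelow M j) → M < n + a → 3 ≤ d (+ n) gens
    3≤d {M} {n} cover M<n+a with j , u , v , j<a , j≡n ← residue n
      with three r r′ r″ p≢p′ p≢p″ p′≢p″ ← cover j j<a =
      injective⇒≤ {f = from ∘ σ} λ eq → σ-injective _ _ (cong proj₁ (from-injective eq))
      where
      open Inverse (d-correct (+ n) gens≢0) using (to; from; strictlyInverseˡ)

      from-injective : ∀ {i j} → from i ≡ from j → i ≡ j
      from-injective {i} {j} eq = trans (sym (strictlyInverseˡ i)) (trans (cong to eq) (strictlyInverseˡ j))

      to-solution : ∀ {y z} → Reaches M j y z → Solution (+ n) gens
      to-solution r = let x , eq = solution M<n+a j≡n r in _ , eq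

      σ : Fin 3 → Solution (+ n) gens
      σ zero             = to-solution r
      σ (suc zero)       = to-solution r′
      σ (suc (suc zero)) = to-solution r″

      yz : Vec ℕ 3 → ℕ × ℕ
      yz (_ Vec.∷ y Vec.∷ z Vec.∷ Vec.[]) = y , z

      σ-injective : ∀ i j → proj₁ (σ i) ≡ proj₁ (σ j) → i ≡ j
      σ-injective zero             zero             _  = refl
      σ-injective zero             (suc zero)       eq = contradiction (cong yz eq) p≢p′
      σ-injective zero             (suc (suc zero)) eq = contradiction (cong yz eq) p≢p″
      σ-injective (suc zero)       zero             eq = contradiction (cong yz (sym eq)) p≢p′
      σ-injective (suc zero)       (suc zero)       _  = refl
      σ-injective (suc zero)       (suc (suc zero)) eq = contradiction (cong yz eq) p′≢p″
      σ-injective (suc (suc zero)) zero             eq = contradiction (cong yz (sym eq)) p≢p″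
      σ-injective (suc (suc zero)) (suc zero)       eq = contradiction (cong yz (sym eq)) p′≢p″
      σ-injective (suc (suc zero)) (suc (suc zero)) _  = refl

    isFrobenius : ∀ Y Z {p p′} → a ≤ b * Y + c * Z → Y ≤ 3 * a → AtMostTwo a q (suc (Y + q * Z)) Z p p′ →
                  (∀ j → j < a → ThreeBelow (b * Y + c * Z) j) →
                  IsFrobenius 2 gens (+ (b * Y + c * Z) ℤ.- + a)
    isFrobenius Y Z a≤M Y≤3a two cover = record
      { positive = gens≢0
      ; coprime  = begin
          gcd a (gcd b (gcd c 0)) ≡⟨ gcd-assoc a b (gcd c 0) ⟨
          gcd (gcd a b) (gcd c 0) ≡⟨ cong (λ u → gcd u (gcd c 0)) (coprime⇒gcd≡1 coprime) ⟩
          gcd 1 (gcd c 0)         ≡⟨ gcd-zeroˡ (gcd c 0) ⟩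
          1                       ∎
      ; d≤p      = d≤2 {Y} {Z} Y≤3a two
      ; greatest = greatest
      }
      where
      open ≡-Reasoning
      M = b * Y + c * Z
      g≡M∸a : + M ℤ.- + a ≡ + (M ∸ a)
      g≡M∸a = trans (ℤ.m-n≡m⊖n M a) (ℤ.⊖-≥ a≤M)
      greatest : ∀ n → d n gens ≤ 2 → n ℤ.≤ + M ℤ.- + a
      -- By `a ≤ M` the claimed value is a natural number, so it exceeds every negative integer
      -- whatever the count there.
      greatest n@(-[1+ _ ]) _ = subst (n ℤ.≤_) (sym g≡M∸a) ℤ.-≤+
      greatest (+ n) d≤2 with n ≤? M ∸ a
      ... | yes n≤M∸a = subst (+ n ℤ.≤_) (sym g≡M∸a) (ℤ.+≤+ n≤M∸a)
      ... | no  n≰M∸a = contradiction (3≤d cover M<n+a) (<⇒≱ (s≤s d≤2))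
        where
        M<n+a : M < n + a
        M<n+a = subst (_< n + a) (m∸n+n≡m a≤M) (+-monoˡ-< a (≰⇒> n≰M∸a))

  -- Lattice points below the line a t + q z = B

  -- The region is closed downwards, so one corner outside it excludes the whole quadrant above that
  -- corner.
  outside : ∀ a q {B t z} t₀ z₀ → B ≤ a * t₀ + q * z₀ → t₀ ≤ t → z₀ ≤ z → ¬ a * t + q * z < B
  outside a q t₀ z₀ B≤ t₀≤t z₀≤z = ≤⇒≯ (≤-trans B≤ (+-mono-≤ (*-monoʳ-≤ a t₀≤t) (*-monoʳ-≤ q z₀≤z)))

  -- The three bounds exclude the corners `(3 , 0)`, `(1 , 1)` and `(0 , suc Z)`. The last one
  -- empties the column `t = 0`, where `z > Z` is demanded.
  atMostTwo-z≡0 : ∀ a q {B Z} → B ≤ 3 * a → B ≤ a + q → B ≤ q * suc Z → AtMostTwo a q B Z (1 , 0) (2 , 0)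
  atMostTwo-z≡0 a q {B} {Z} B≤3a B≤a+q B≤q[1+Z] = go
    where
    go : AtMostTwo a q B Z (1 , 0) (2 , 0)
    go 0 z lt Z<z = contradiction lt (outside a q {t = 0} {z} 0 (suc Z) (≤-trans B≤q[1+Z] (m≤n+m _ (a * 0))) z≤n (Z<z refl))
    go 1 0 _ _ = inj₁ refl
    go 2 0 _ _ = inj₂ refl
    go (suc (suc (suc t))) 0 lt _ = contradiction lt (outside a q {t = suc (suc (suc t))} {0} 3 0
      (≤-trans B≤3a (≤-reflexive (solve (a ∷ q ∷ [])))) (s≤s (s≤s (s≤s z≤n))) z≤n)
    go (suc t) (suc z) lt _ = contradiction lt (outside a q {t = suc t} {suc z} 1 1
      (≤-trans B≤a+q (≤-reflexive (solve (a ∷ q ∷ [])))) (s≤s z≤n) (s≤s z≤n))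

  -- Excluded corners: `(2 , 0)`, `(1 , 2)` and again `(0 , suc Z)`.
  atMostTwo-t≡1 : ∀ a q {B Z} → B ≤ 2 * a → B ≤ a + 2 * q → B ≤ q * suc Z → AtMostTwo a q B Z (1 , 0) (1 , 1)
  atMostTwo-t≡1 a q {B} {Z} B≤2a B≤a+2q B≤q[1+Z] = go
    where
    go : AtMostTwo a q B Z (1 , 0) (1 , 1)
    go 0 z lt Z<z = contradiction lt (outside a q {t = 0} {z} 0 (suc Z) (≤-trans B≤q[1+Z] (m≤n+m _ (a * 0))) z≤n (Z<z refl))
    go 1 0 _ _ = inj₁ refl
    go 1 1 _ _ = inj₂ refl
    go 1 (suc (suc z)) lt _ = contradiction lt (outside a q {t = 1} {suc (suc z)} 1 2
      (≤-trans B≤a+2q (≤-reflexive (solve (a ∷ q ∷ [])))) (s≤s z≤n) (s≤s (s≤s z≤n)))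
    go (suc (suc t)) z lt _ = contradiction lt (outside a q {t = suc (suc t)} {z} 2 0
      (≤-trans B≤2a (≤-reflexive (solve (a ∷ q ∷ [])))) (s≤s (s≤s z≤n)) z≤n)

  -- Excluded corners: `(2 , 0)`, `(1 , 1)` and `(0 , 2)`. With `Z = 0` the demand on the column
  -- `t = 0` removes only the origin.
  atMostTwo-t+z≡1 : ∀ a q {B} → B ≤ 2 * a → B ≤ a + q → B ≤ 2 * q → AtMostTwo a q B 0 (0 , 1) (1 , 0)
  atMostTwo-t+z≡1 a q {B} B≤2a B≤a+q B≤2q = go
    where
    go : AtMostTwo a q B 0 (0 , 1) (1 , 0)
    go 0 0 _ 0<0 = contradiction (0<0 refl) λ ()
    go 0 1 _ _ = inj₁ refl
    go 0 (suc (suc z)) lt _ = contradiction lt (outside a q {t = 0} {suc (suc z)} 0 2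
      (≤-trans B≤2q (≤-reflexive (solve (a ∷ q ∷ [])))) z≤n (s≤s (s≤s z≤n)))
    go 1 0 _ _ = inj₂ refl
    go (suc t) (suc z) lt _ = contradiction lt (outside a q {t = suc t} {suc z} 1 1
      (≤-trans B≤a+q (≤-reflexive (solve (a ∷ q ∷ [])))) (s≤s z≤n) (s≤s z≤n))
    go (suc (suc t)) 0 lt _ = contradiction lt (outside a q {t = suc (suc t)} {0} 2 0
      (≤-trans B≤2a (≤-reflexive (solve (a ∷ q ∷ [])))) (s≤s (s≤s z≤n)) z≤n)

  -- The Frobenius value for each size of q against a

  module _ {a b c q s : ℕ} (G : Generators a b c q s) where
    open Generators G

    private
      gens : Vec ℕ 3
      gens = a Vec.∷ b Vec.∷ c Vec.∷ Vec.[]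

      fst≢ : ∀ {y y′ z z′ : ℕ} → y ≢ y′ → (y , z) ≢ (y′ , z′)
      fst≢ y≢y′ eq = y≢y′ (cong proj₁ eq)

      snd≢ : ∀ {y y′ z z′ : ℕ} → z ≢ z′ → (y , z) ≢ (y′ , z′)
      snd≢ z≢z′ eq = z≢z′ (cong proj₂ eq)

      m≢m+n : ∀ m {n} → 1 ≤ n → m ≢ m + n
      m≢m+n m 1≤n = <⇒≢ (≤-trans (≤-reflexive (+-comm 1 m)) (+-monoʳ-≤ m 1≤n))

      bq≡c+sa : b * q ≡ c + s * a
      bq≡c+sa = trans (*-comm b q) (sym c+sa≡qb)

      sa≤c : s * a ≤ c
      sa≤c = m+n≤o⇒m≤o (s * a) (3sa≤c G)

      2sa≤c : 2 * (s * a) ≤ c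
      2sa≤c = ≤-trans (*-monoˡ-≤ (s * a) {2} {3} (s≤s (s≤s z≤n))) (3sa≤c G)

      c≤bq : c ≤ b * q
      c≤bq = ≤-by (s * a) (sym bq≡c+sa)

      a≤b*n : ∀ {n} → 1 ≤ n → a ≤ b * n
      a≤b*n {n} 1≤n = ≤-trans (m+n≤o⇒m≤o a 2a≤b) (m≤m*n b n {{>-nonZero 1≤n}})

      a≤c*n : ∀ {n} → 1 ≤ n → a ≤ c * n
      a≤c*n {n} 1≤n = ≤-trans (a≤c G) (m≤m*n c n {{>-nonZero 1≤n}})

      on-axis-≤ : ∀ {y y′ M} → y ≤ y′ → b * y′ ≤ M → b * y + c * 0 ≤ M
      on-axis-≤ {y} {y′} {M} y≤y′ by′≤M = begin
        b * y + c * 0 ≡⟨ solve (b ∷ y ∷ c ∷ []) ⟩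
        b * y         ≤⟨ *-monoʳ-≤ b y≤y′ ⟩
        b * y′        ≤⟨ by′≤M ⟩
        M             ∎
        where open ≤-Reasoning

      on-axis : ∀ n {j Y M} → j < a → suc n * a ≤ suc Y → b * Y ≤ M → Reaches G M j (j + n * a) 0
      on-axis n {j} j<a na+a≤1+Y bY≤M = reaches {w = 0} {n} (solve (j ∷ n ∷ a ∷ q ∷ []))
        (on-axis-≤ (s≤s⁻¹ (≤-trans (+-monoˡ-≤ (n * a) j<a) na+a≤1+Y)) bY≤M)

      j≢j+na : ∀ {j} n → 1 ≤ n → (j , 0) ≢ (j + n * a , 0)
      j≢j+na {j} n 1≤n = fst≢ (m≢m+n j (*-mono-≤ 1≤n 1≤a))

      j-on-axis : ∀ {j y M} → j ≤ y → b * y ≤ M → Reaches G M j j 0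
      j-on-axis {j} j≤y by≤M = reaches {w = 0} {0} (solve (j ∷ q ∷ a ∷ [])) (on-axis-≤ j≤y by≤M)

    -- Each class takes its first three points on the axis `z = 0`. The worst class is that of
    -- `a − 1`, whose third point `y = 3 a − 1` is `Y`.
    isFrobenius-3a≤q : ∀ {Y} → suc Y ≡ 3 * a → 3 * a ≤ q → IsFrobenius 2 gens (+ (b * Y + c * 0) ℤ.- + a)
    isFrobenius-3a≤q {Y} 1+Y≡3a 3a≤q = isFrobenius G Y 0 (m≤n⇒m≤n+o (c * 0) (a≤b*n 1≤Y)) (<⇒≤ (≤-reflexive 1+Y≡3a))
      (atMostTwo-z≡0 a q B≤3a (≤-trans B≤3a (≤-trans 3a≤q (m≤n+m q a)))
        (≤-trans B≤3a (≤-trans 3a≤q (≤-reflexive (sym (*-identityʳ q))))))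
      λ j j<a → three
        (j-on-axis (s≤s⁻¹ (≤-trans j<a (m+n≤o⇒m≤o a 3a≤1+Y))) bY≤M)
        (on-axis 1 j<a (≤-trans (*-monoˡ-≤ a {2} {3} (s≤s (s≤s z≤n))) 3a≤1+Y) bY≤M)
        (on-axis 2 j<a 3a≤1+Y bY≤M)
        (j≢j+na 1 (s≤s z≤n)) (j≢j+na 2 (s≤s z≤n))
        (fst≢ λ eq → <⇒≢ (*-monoˡ-< a {{>-nonZero 1≤a}} {1} {2} ≤-refl) (+-cancelˡ-≡ j _ _ eq))
      where
      3a≤1+Y = ≤-reflexive (sym 1+Y≡3a)
      1≤Y : 1 ≤ Y
      1≤Y = s≤s⁻¹ (≤-trans (≤-trans (s≤s (s≤s z≤n)) (*-monoʳ-≤ 3 1≤a)) 3a≤1+Y)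
      B≤3a : suc (Y + q * 0) ≤ 3 * a
      B≤3a = ≤-reflexive (trans (cong suc (trans (cong (λ u → Y + u) (*-zeroʳ q)) (+-identityʳ Y))) 1+Y≡3a)
      bY≤M : b * Y ≤ b * Y + c * 0
      bY≤M = m≤m+n _ _

    -- Two points on the axis cost at most `b (2 a − 1)`, and one point with `z = 1` and `y < a`
    -- costs at most `b (a − 1) + c`. These bounds differ by `c − a b`, so the larger one is the
    -- value `M` in one of the next two lemmas.
    threeBelow-wide : ∀ {M a′ Y} → suc a′ ≡ a → suc Y ≡ 2 * a → b * Y ≤ M → b * a′ + c ≤ M →
                      ∀ j → j < a → ThreeBelow G M j
    threeBelow-wide {M} {a′} {Y} refl 1+Y≡2a bY≤M ba′+c≤M j j<a = three
      (j-on-axis (s≤s⁻¹ (≤-trans j<a (m+n≤o⇒m≤o a 2a≤1+Y))) bY≤M)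
      (on-axis 1 j<a 2a≤1+Y bY≤M)
      (reaches {w = N / a} {q} congruent (begin
        b * (N % a) + c * 1 ≤⟨ +-mono-≤ (*-monoʳ-≤ b (s≤s⁻¹ (m%n<n N a))) (≤-reflexive (*-identityʳ c)) ⟩
        b * a′ + c          ≤⟨ ba′+c≤M ⟩
        M                   ∎))
      (j≢j+na 1 (s≤s z≤n)) (snd≢ λ ()) (snd≢ λ ())
      where
      open ≤-Reasoning
      2a≤1+Y = ≤-reflexive (sym 1+Y≡2a)
      -- As `a′ ≡ −1` modulo `a`, this is `j − q`, the residue that `y` must have when `z = 1`.
      N = j + q * a′
      congruent : N % a + q * 1 + a * (N / a) ≡ j + a * q
      congruent = begin-equality
        N % a + q * 1 + a * (N / a) ≡⟨ regroup (N % a) (N / a) a ⟩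
        (N % a + N / a * a) + q     ≡⟨ cong (_+ q) (m≡m%n+[m/n]*n N a) ⟨
        N + q                       ≡⟨ regroup′ a′ ⟩
        j + a * q                   ∎
        where
        regroup : ∀ m o a → m + q * 1 + a * o ≡ (m + o * a) + q
        regroup m o a = solve (m ∷ o ∷ a ∷ q ∷ [])
        regroup′ : ∀ a′ → j + q * a′ + q ≡ j + (1 + a′) * q
        regroup′ a′ = solve (j ∷ a′ ∷ q ∷ [])

    isFrobenius-ab≤c : ∀ {a′} → suc a′ ≡ a → a ≤ q → q ≤ 2 * a → a * b ≤ c →
                       IsFrobenius 2 gens (+ (b * a′ + c * 1) ℤ.- + a)
    isFrobenius-ab≤c {a′} refl a≤q q≤2a ab≤c = isFrobenius G a′ 1
      (≤-trans (a≤c*n ≤-refl) (m≤n+m (c * 1) (b * a′))) (≤-trans (n≤1+n a′) (m≤m+n a _))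
      (atMostTwo-z≡0 a q {Z = 1}
        (+-monoʳ-≤ a (≤-trans (≤-reflexive (*-identityʳ q)) q≤2a))
        (+-monoʳ-≤ a (≤-reflexive (*-identityʳ q)))
        (begin
          a + q * 1 ≤⟨ +-monoˡ-≤ (q * 1) a≤q ⟩
          q + q * 1 ≡⟨ solve (q ∷ []) ⟩
          q * 2     ∎))
      (threeBelow-wide {Y = a′ + a} refl (cong (λ u → a + u) (sym (+-identityʳ a)))
        (begin
          b * (a′ + a)   ≡⟨ expand a ⟩
          b * a′ + a * b ≤⟨ +-monoʳ-≤ (b * a′) ab≤c ⟩
          b * a′ + c     ≡⟨ cong (λ u → b * a′ + u) (*-identityʳ c) ⟨
          b * a′ + c * 1 ∎)
        (≤-reflexive (cong (λ u → b * a′ + u) (sym (*-identityʳ c)))))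
      where
      open ≤-Reasoning
      expand : ∀ a → b * (a′ + a) ≡ b * a′ + a * b
      expand a = solve (a′ ∷ a ∷ b ∷ [])

    isFrobenius-c≤ab : ∀ {Y} → suc Y ≡ 2 * a → a ≤ q → c ≤ a * b →
                       IsFrobenius 2 gens (+ (b * Y + c * 0) ℤ.- + a)
    isFrobenius-c≤ab {Y} 1+Y≡2a a≤q c≤ab with a′ , refl ← m≤n⇒∃[o]m+o≡n 1≤a = isFrobenius G Y 0
      (m≤n⇒m≤n+o (c * 0) (a≤b*n (subst (1 ≤_) (sym Y≡) (m≤n⇒m≤o+n a′ 1≤a))))
      (≤-trans (n≤1+n Y) (≤-trans (≤-reflexive 1+Y≡2a) (*-monoˡ-≤ a {2} {3} (s≤s (s≤s z≤n)))))
      (atMostTwo-t+z≡1 a q B≤2a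
        (≤-trans B≤2a (+-monoʳ-≤ a (≤-trans (≤-reflexive (+-identityʳ a)) a≤q)))
        (≤-trans B≤2a (*-monoʳ-≤ 2 a≤q)))
      (threeBelow-wide refl 1+Y≡2a (m≤m+n _ _) (begin
        b * a′ + c     ≤⟨ +-monoʳ-≤ (b * a′) c≤ab ⟩
        b * a′ + a * b ≡⟨ expand a ⟨
        b * (a′ + a)   ≡⟨ cong (b *_) Y≡ ⟨
        b * Y          ≤⟨ m≤m+n _ _ ⟩
        b * Y + c * 0  ∎))
      where
      open ≤-Reasoning
      expand : ∀ a → b * (a′ + a) ≡ b * a′ + a * b
      expand a = solve (a′ ∷ a ∷ b ∷ [])
      Y≡ : Y ≡ a′ + a
      Y≡ = suc-injective (trans 1+Y≡2a (cong (λ u → a + u) (+-identityʳ a)))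
      B≤2a : suc (Y + q * 0) ≤ 2 * a
      B≤2a = ≤-reflexive (trans (cong suc (trans (cong (λ u → Y + u) (*-zeroʳ q)) (+-identityʳ Y))) 1+Y≡2a)

    -- Since `q ≡ −s` modulo `a`, raising `z` by one is offset by raising `y` by `s`. In the class
    -- of `a − 1` this leads from `(a − 1 , 0)` to `(s − 1 , 1)` and `(2 s − 1 , 2)`, and the last
    -- of these is `(Y , Z)`.
    isFrobenius-q+s≡a : ∀ {Y} → suc Y ≡ 2 * s → q + s ≡ a →
                        IsFrobenius 2 gens (+ (b * Y + c * 2) ℤ.- + a)
    isFrobenius-q+s≡a {Y} 1+Y≡2s q+s≡a = isFrobenius G Y 2
      (≤-trans (a≤c*n (s≤s z≤n)) (m≤n+m (c * 2) (b * Y)))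
      (≤-trans (n≤1+n Y) (≤-trans (≤-reflexive 1+Y≡2s) (*-mono-≤ {2} {3} (s≤s (s≤s z≤n)) s≤a)))
      (atMostTwo-t≡1 a q (≤-reflexive B≡2a)
        (≤-trans (≤-reflexive B≡2a) (+-monoʳ-≤ a (≤-trans (≤-reflexive (+-identityʳ a)) a≤2q)))
        (begin
          suc Y + q * 2 ≡⟨ cong (_+ q * 2) 1+Y≡2s ⟩
          2 * s + q * 2 ≤⟨ +-monoˡ-≤ (q * 2) 2s≤q ⟩
          q + q * 2     ≡⟨ solve (q ∷ []) ⟩
          q * 3         ∎))
      cover
      where
      open ≤-Reasoning
      M = b * Y + c * 2
      s≤q : s ≤ q
      s≤q = m+n≤o⇒m≤o s 2s≤q
      s≤a : s ≤ a
      s≤a = ≤-by q (trans (+-comm s q) q+s≡a)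
      a≤2q : a ≤ 2 * q
      a≤2q = begin
        a         ≡⟨ q+s≡a ⟨
        q + s     ≤⟨ +-monoʳ-≤ q s≤q ⟩
        q + q     ≡⟨ solve (q ∷ []) ⟩
        2 * q     ∎
      B≡2a : suc Y + q * 2 ≡ 2 * a
      B≡2a = begin-equality
        suc Y + q * 2 ≡⟨ cong (_+ q * 2) 1+Y≡2s ⟩
        2 * s + q * 2 ≡⟨ solve (s ∷ q ∷ []) ⟩
        2 * (q + s)   ≡⟨ cong (2 *_) q+s≡a ⟩
        2 * a         ∎

      -- Two copies of `c` fall short of `2 q b` by `2 s a ≤ s b`, that is, by at most `s` units of
      -- `y`; the hypothesis `j + s < a` leaves exactly that room.
      b[a+j]≤M : ∀ j → j + s < a → b * (a + j) ≤ M
      b[a+j]≤M j j+s<a = +-cancelʳ-≤ (2 * (s * a)) _ _ (begin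
        b * (a + j) + 2 * (s * a)     ≡⟨ solve (a ∷ b ∷ j ∷ s ∷ []) ⟩
        b * (a + j) + s * (2 * a)     ≤⟨ +-monoʳ-≤ (b * (a + j)) (*-monoʳ-≤ s 2a≤b) ⟩
        b * (a + j) + s * b           ≡⟨ solve (a ∷ b ∷ j ∷ s ∷ []) ⟩
        b * (a + (j + s))             ≤⟨ *-monoʳ-≤ b (s≤s⁻¹ (≤-trans (≤-reflexive (sym (+-suc a (j + s))))
                                           (≤-trans (+-monoʳ-≤ a j+s<a) (≤-reflexive a+a≡)))) ⟩
        b * (Y + q * 2)               ≡⟨ solve (b ∷ Y ∷ q ∷ []) ⟩
        b * Y + 2 * (b * q)           ≡⟨ cong (λ u → b * Y + 2 * u) bq≡c+sa ⟩
        b * Y + 2 * (c + s * a)       ≡⟨ solve (b ∷ Y ∷ c ∷ s ∷ a ∷ []) ⟩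
        b * Y + c * 2 + 2 * (s * a)   ∎)
        where
        a+a≡ : a + a ≡ suc (Y + q * 2)
        a+a≡ = trans (cong (λ u → a + u) (sym (+-identityʳ a))) (sym B≡2a)

      ba≤M : b * a ≤ M
      ba≤M = begin
        b * a       ≡⟨ cong (b *_) (+-identityʳ a) ⟨
        b * (a + 0) ≤⟨ b[a+j]≤M 0 (≤-trans (+-monoˡ-≤ s (1≤q G)) (≤-reflexive q+s≡a)) ⟩
        M           ∎

      below : ∀ {y z} → y ≤ Y → z ≤ 2 → b * y + c * z ≤ M
      below y≤Y z≤2 = +-mono-≤ (*-monoʳ-≤ b y≤Y) (*-monoʳ-≤ c z≤2)

      cover : ∀ j → j < a → ThreeBelow G M j
      cover j j<a with j + s <? a
      ... | yes j+s<a = three {y′ = a + j}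
        (j-on-axis (<⇒≤ j<a) ba≤M)
        (reaches {w = 0} {1} (solve (j ∷ q ∷ a ∷ [])) (on-axis-≤ ≤-refl (b[a+j]≤M j j+s<a)))
        (reaches {w = 0} {1} congruent (begin
          b * (j + s) + c * 1 ≤⟨ +-monoʳ-≤ (b * (j + s)) (≤-trans (≤-reflexive (*-identityʳ c)) c≤bq) ⟩
          b * (j + s) + b * q ≡⟨ solve (b ∷ j ∷ s ∷ q ∷ []) ⟩
          b * (q + s + j)     ≡⟨ cong (λ u → b * (u + j)) q+s≡a ⟩
          b * (a + j)         ≤⟨ b[a+j]≤M j j+s<a ⟩
          M                   ∎))
        (fst≢ λ eq → m≢m+n j 1≤a (trans eq (+-comm a j))) (snd≢ λ ()) (snd≢ λ ())
        where
        congruent : j + s + q * 1 + a * 0 ≡ j + a * 1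
        congruent = begin-equality
          j + s + q * 1 + a * 0 ≡⟨ solve (j ∷ s ∷ q ∷ a ∷ []) ⟩
          j + (q + s) * 1       ≡⟨ cong (λ u → j + u * 1) q+s≡a ⟩
          j + a * 1             ∎
      ... | no  j+s≮a with y , a+y≡j+s ← m≤n⇒∃[o]m+o≡n (≮⇒≥ j+s≮a) = three
        (j-on-axis (<⇒≤ j<a) ba≤M)
        (reaches {w = 1} {1} congruent (below (≤-trans (m≤m+n y s) y+s≤Y) (s≤s z≤n)))
        (reaches {w = 1} {2} congruent′ (below y+s≤Y ≤-refl))
        (snd≢ λ ()) (snd≢ λ ()) (snd≢ λ ())
        where
        y<s : y < s
        y<s = +-cancelˡ-< a y s (≤-trans (s≤s (≤-reflexive a+y≡j+s)) (+-monoˡ-≤ s j<a))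
        y+s≤Y : y + s ≤ Y
        y+s≤Y = s≤s⁻¹ (begin
          suc y + s ≤⟨ +-monoˡ-≤ s y<s ⟩
          s + s     ≡⟨ solve (s ∷ []) ⟩
          2 * s     ≡⟨ 1+Y≡2s ⟨
          suc Y     ∎)
        congruent : y + q * 1 + a * 1 ≡ j + a * 1
        congruent = begin-equality
          y + q * 1 + a * 1     ≡⟨ solve (y ∷ q ∷ a ∷ []) ⟩
          (a + y) + q           ≡⟨ cong (_+ q) a+y≡j+s ⟩
          j + s + q             ≡⟨ solve (j ∷ s ∷ q ∷ []) ⟩
          j + (q + s) * 1       ≡⟨ cong (λ u → j + u * 1) q+s≡a ⟩
          j + a * 1             ∎
        congruent′ : y + s + q * 2 + a * 1 ≡ j + a * 2
        congruent′ = begin-equality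
          y + s + q * 2 + a * 1 ≡⟨ solve (y ∷ s ∷ q ∷ a ∷ []) ⟩
          (a + y) + s + q * 2   ≡⟨ cong (λ u → u + s + q * 2) a+y≡j+s ⟩
          j + s + s + q * 2     ≡⟨ solve (j ∷ s ∷ q ∷ []) ⟩
          j + (q + s) * 2       ≡⟨ cong (λ u → j + u * 2) q+s≡a ⟩
          j + a * 2             ∎

    -- With `j = y + z q` and `y < q`, a class is traversed by two moves: trading one `z` for `q`
    -- units of `y`, and adding `a = r q + e`, which raises `z` by `r` and `y` by `e`, with a carry
    -- when `y + e ≥ q`. Only a carry calls for the bound at `z = 2 + r`, and it leaves `y < e`;
    -- hence the two rectangles.
    threeBelow-/ : ∀ {M r e} → a ≡ r * q + e → e ≤ q → 1 ≤ r →
                   (∀ {y z} → y < q → z ≤ suc r → b * y + c * z ≤ M) →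
                   (∀ {y z} → y < e → z ≤ 2 + r → b * y + c * z ≤ M) →
                   ∀ j → j < a → ThreeBelow G M j
    threeBelow-/ {M} {suc r′} {e} a≡ e≤q (s≤s z≤n) below-q below-e j j<a =
      subst (ThreeBelow G M) (sym j≡) (go (j % q) (j / q) (m%n<n j q) z≤r)
      where
      r = suc r′
      instance
        q≢0 : NonZero q
        q≢0 = >-nonZero (1≤q G)
      open ≤-Reasoning

      j≡ : j ≡ j % q + j / q * q
      j≡ = m≡m%n+[m/n]*n j q

      z≤r : j / q ≤ r
      z≤r = s≤s⁻¹ (*-cancelʳ-< q (j / q) (suc r) (begin-strict
        j / q * q ≤⟨ m/n*n≤m j q ⟩
        j         <⟨ j<a ⟩
        a         ≡⟨ a≡ ⟩
        r * q + e ≤⟨ +-monoʳ-≤ (r * q) e≤q ⟩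
        r * q + q ≡⟨ +-comm (r * q) q ⟩
        suc r * q ∎))

      -- Points with `y ≥ q` are charged to points of the rectangles: `b q = c + s a` is at most
      -- `2 c`, and `2 b q` is at most `3 c`.
      shift₁ : ∀ y z → b * (y + q) + c * z ≤ b * y + c * (2 + z)
      shift₁ y z = begin
        b * (y + q) + c * z               ≡⟨ solve (b ∷ y ∷ q ∷ c ∷ z ∷ []) ⟩
        b * y + b * q + c * z             ≡⟨ cong (λ u → b * y + u + c * z) bq≡c+sa ⟩
        b * y + (c + s * a) + c * z       ≤⟨ +-monoˡ-≤ (c * z) (+-monoʳ-≤ (b * y) (+-monoʳ-≤ c sa≤c)) ⟩
        b * y + (c + c) + c * z           ≡⟨ solve (b ∷ y ∷ c ∷ z ∷ []) ⟩
        b * y + c * (2 + z)               ∎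

      shift₂ : ∀ y z → b * (y + 2 * q) + c * z ≤ b * y + c * (3 + z)
      shift₂ y z = begin
        b * (y + 2 * q) + c * z             ≡⟨ solve (b ∷ y ∷ q ∷ c ∷ z ∷ []) ⟩
        b * y + 2 * (b * q) + c * z         ≡⟨ cong (λ u → b * y + 2 * u + c * z) bq≡c+sa ⟩
        b * y + 2 * (c + s * a) + c * z     ≡⟨ solve (b ∷ y ∷ c ∷ s ∷ a ∷ z ∷ []) ⟩
        b * y + c * (2 + z) + 2 * (s * a)   ≤⟨ +-monoʳ-≤ (b * y + c * (2 + z)) 2sa≤c ⟩
        b * y + c * (2 + z) + c             ≡⟨ solve (b ∷ y ∷ c ∷ z ∷ []) ⟩
        b * y + c * (3 + z)                 ∎

      same-class : ∀ y z {y′ z′} t → y′ + q * z′ ≡ y + q * z + t * (r * q + e) →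
                   y′ + q * z′ + a * 0 ≡ y + z * q + a * t
      same-class y z {y′} {z′} t eq = begin-equality
        y′ + q * z′ + a * 0           ≡⟨ solve (y′ ∷ q ∷ z′ ∷ a ∷ []) ⟩
        y′ + q * z′                   ≡⟨ eq ⟩
        y + q * z + t * (r * q + e)   ≡⟨ cong (λ u → y + q * z + t * u) a≡ ⟨
        y + q * z + t * a             ≡⟨ solve (y ∷ q ∷ z ∷ t ∷ a ∷ []) ⟩
        y + z * q + a * t             ∎

      same-class₀ : ∀ y z {y′ z′} → y′ + q * z′ ≡ y + q * z → y′ + q * z′ + a * 0 ≡ y + z * q + a * 0
      same-class₀ y z eq = same-class y z 0 (trans eq (sym (+-identityʳ (y + q * z))))

      itself : ∀ y z → y < q → z ≤ r → Reaches G M (y + z * q) y z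
      itself y z y<q z≤r =
        reaches {w = 0} {0} (same-class₀ y z refl) (below-q y<q (m≤n⇒m≤1+n z≤r))

      back : ∀ m n → m + q + q * n ≡ m + q * suc n
      back m n = solve (m ∷ q ∷ n ∷ [])

      ahead : ∀ r y z → y + e + q * (z + r) ≡ y + q * z + 1 * (r * q + e)
      ahead r y z = solve (y ∷ e ∷ q ∷ z ∷ r ∷ [])

      wrap : ∀ {y y′} z → q + y′ ≡ y + e → y′ + q * suc (z + r) ≡ y + q * z + 1 * (r * q + e)
      wrap {y} {y′} z eq = begin-equality
        y′ + q * suc (z + r)          ≡⟨ back y′ (z + r) ⟨
        y′ + q + q * (z + r)          ≡⟨ cong (_+ q * (z + r)) (trans (+-comm y′ q) eq) ⟩
        y + e + q * (z + r)           ≡⟨ ahead r y z ⟩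
        y + q * z + 1 * (r * q + e)   ∎

      wrap-< : ∀ {y y′} → y < q → q + y′ ≡ y + e → y′ < e
      wrap-< {y} {y′} y<q eq = +-cancelˡ-< q y′ e (begin-strict
        q + y′ ≡⟨ eq ⟩
        y + e  <⟨ +-monoˡ-< e y<q ⟩
        q + e  ∎)

      go : ∀ y z → y < q → z ≤ r → ThreeBelow G M (y + z * q)
      go y (suc (suc z)) y<q z≤r = three {y′ = y + q} {suc z} {y + 2 * q} {z}
        (itself y (2 + z) y<q z≤r)
        (reaches {w = 0} {0} (same-class₀ y (2 + z) (back y (suc z)))
          (≤-trans (shift₁ y (suc z)) (below-q y<q (s≤s z≤r))))
        (reaches {w = 0} {0} (same-class₀ y (2 + z) (solve (y ∷ q ∷ z ∷ [])))
          (≤-trans (shift₂ y z) (below-q y<q (s≤s z≤r))))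
        (snd≢ λ ()) (snd≢ λ ()) (snd≢ λ ())
      go y 1 y<q 1≤r with y + e <? q
      ... | yes y+e<q = three {y′ = y + q} {0} {y + e} {suc r}
        (itself y 1 y<q 1≤r)
        (reaches {w = 0} {0} (same-class₀ y 1 (back y 0))
          (≤-trans (shift₁ y 0) (below-q y<q (s≤s 1≤r))))
        (reaches {w = 0} {1} (same-class y 1 1 (ahead r y 1)) (below-q y+e<q ≤-refl))
        (snd≢ λ ()) (snd≢ λ ()) (snd≢ λ ())
      ... | no y+e≮q with y′ , q+y′≡y+e ← m≤n⇒∃[o]m+o≡n (≮⇒≥ y+e≮q) = three {y′ = y + q} {0} {y′} {2 + r}
        (itself y 1 y<q 1≤r)
        (reaches {w = 0} {0} (same-class₀ y 1 (back y 0))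
          (≤-trans (shift₁ y 0) (below-q y<q (s≤s 1≤r))))
        (reaches {w = 0} {1} (same-class y 1 1 (wrap 1 q+y′≡y+e)) (below-e (wrap-< y<q q+y′≡y+e) ≤-refl))
        (snd≢ λ ()) (snd≢ λ ()) (snd≢ λ ())
      go y 0 y<q _ with y + e <? q
      ... | yes y+e<q = three {y′ = y + e} {r} {y + e + q} {r′}
        (itself y 0 y<q z≤n)
        (reaches {w = 0} {1} (same-class y 0 1 (ahead r y 0)) (below-q y+e<q (n≤1+n r)))
        (reaches {w = 0} {1} (same-class y 0 1 (trans (back (y + e) r′) (ahead r y 0)))
          (≤-trans (shift₁ (y + e) r′) (below-q y+e<q ≤-refl)))
        (snd≢ λ ())
        (fst≢ λ eq → m≢m+n y (≤-trans (1≤q G) (m≤n+m q e)) (trans eq (+-assoc y e q)))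
        (snd≢ (≢-sym (<⇒≢ ≤-refl)))
      ... | no y+e≮q with y′ , q+y′≡y+e ← m≤n⇒∃[o]m+o≡n (≮⇒≥ y+e≮q) = three {y′ = y′ + q} {r} {y′} {suc r}
        (itself y 0 y<q z≤n)
        (reaches {w = 0} {1} (same-class y 0 1 (trans (back y′ r) (wrap 0 q+y′≡y+e)))
          (≤-trans (shift₁ y′ r) (below-e (wrap-< y<q q+y′≡y+e) ≤-refl)))
        (reaches {w = 0} {1} (same-class y 0 1 (wrap 0 q+y′≡y+e)) (below-e (wrap-< y<q q+y′≡y+e) (n≤1+n _)))
        (snd≢ λ ()) (snd≢ λ ()) (snd≢ (<⇒≢ ≤-refl))

    -- The values of M here and in isFrobenius-eb≤sa differ by e b − s a: each lemma is the
    -- case in which its own value is the larger.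
    isFrobenius-sa≤eb : ∀ {r e′} → a ≡ r * q + suc e′ → suc e′ ≤ q → 1 ≤ r → 2 * q ≤ a → s * a ≤ suc e′ * b →
                        IsFrobenius 2 gens (+ (b * e′ + c * (2 + r)) ℤ.- + a)
    isFrobenius-sa≤eb {r} {e′} a≡ e≤q 1≤r 2q≤a sa≤eb = isFrobenius G e′ (2 + r)
      (≤-trans (a≤c*n (s≤s z≤n)) (m≤n+m _ (b * e′)))
      (≤-trans e′≤a (m≤m+n a _))
      (atMostTwo-t≡1 a q (begin
          suc e′ + q * (2 + r) ≡⟨ B≡a+2q ⟩
          a + 2 * q            ≤⟨ +-monoʳ-≤ a 2q≤a ⟩
          a + a                ≡⟨ cong (λ u → a + u) (+-identityʳ a) ⟨
          2 * a                ∎)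
        (≤-reflexive B≡a+2q)
        (begin
          suc e′ + q * (2 + r) ≤⟨ +-monoˡ-≤ (q * (2 + r)) e≤q ⟩
          q + q * (2 + r)      ≡⟨ *-suc q (2 + r) ⟨
          q * (3 + r)          ∎))
      (threeBelow-/ a≡ e≤q 1≤r below-q
        λ y<e z≤2+r → +-mono-≤ (*-monoʳ-≤ b (s≤s⁻¹ y<e)) (*-monoʳ-≤ c z≤2+r))
      where
      open ≤-Reasoning
      e′≤a : e′ ≤ a
      e′≤a = begin
        e′             ≤⟨ n≤1+n e′ ⟩
        suc e′         ≤⟨ m≤n+m (suc e′) (r * q) ⟩
        r * q + suc e′ ≡⟨ a≡ ⟨
        a              ∎
      B≡a+2q : suc e′ + q * (2 + r) ≡ a + 2 * q
      B≡a+2q = begin-equality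
        suc e′ + q * (2 + r)       ≡⟨ solve (e′ ∷ q ∷ r ∷ []) ⟩
        r * q + suc e′ + 2 * q     ≡⟨ cong (_+ 2 * q) a≡ ⟨
        a + 2 * q                  ∎

      -- Adding `b` moves the corner `y = q − 1` to `y = q`, where `b q = c + s a` makes the
      -- hypothesis on `s a` applicable.
      below-q : ∀ {y z} → y < q → z ≤ suc r → b * y + c * z ≤ b * e′ + c * (2 + r)
      below-q {y} {z} y<q z≤1+r = +-cancelˡ-≤ b _ _ (begin
        b + (b * y + c * z)                 ≡⟨ solve (b ∷ y ∷ c ∷ z ∷ []) ⟩
        b * suc y + c * z                   ≤⟨ +-mono-≤ (*-monoʳ-≤ b y<q) (*-monoʳ-≤ c z≤1+r) ⟩
        b * q + c * suc r                   ≡⟨ cong (_+ c * suc r) bq≡c+sa ⟩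
        c + s * a + c * suc r               ≤⟨ +-monoˡ-≤ (c * suc r) (+-monoʳ-≤ c sa≤eb) ⟩
        c + suc e′ * b + c * suc r          ≡⟨ solve (c ∷ e′ ∷ b ∷ r ∷ []) ⟩
        b + (b * e′ + c * (2 + r))          ∎)

    isFrobenius-eb≤sa : ∀ {r e q′} → suc q′ ≡ q → a ≡ r * q + e → e ≤ q → 1 ≤ r → 2 * q ≤ a → e * b ≤ s * a →
                        IsFrobenius 2 gens (+ (b * q′ + c * (1 + r)) ℤ.- + a)
    isFrobenius-eb≤sa {r} {e} {q′} refl a≡ e≤q 1≤r 2q≤a eb≤sa = isFrobenius G q′ (1 + r)
      (≤-trans (a≤c*n (s≤s z≤n)) (m≤n+m _ (b * q′)))
      (begin
        q′           ≤⟨ n≤1+n q′ ⟩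
        q            ≤⟨ m≤m+n q _ ⟩
        2 * q        ≤⟨ 2q≤a ⟩
        a            ≤⟨ m≤m+n a _ ⟩
        3 * a        ∎)
      (atMostTwo-t≡1 a q
        (begin
          q + q * (1 + r)   ≡⟨ regroup q ⟩
          q * r + 2 * q     ≤⟨ +-mono-≤ qr≤a 2q≤a ⟩
          a + a             ≡⟨ cong (λ u → a + u) (+-identityʳ a) ⟨
          2 * a             ∎)
        (begin
          q + q * (1 + r)   ≡⟨ regroup q ⟩
          q * r + 2 * q     ≤⟨ +-monoˡ-≤ (2 * q) qr≤a ⟩
          a + 2 * q         ∎)
        (≤-reflexive (sym (*-suc q (1 + r)))))
      (threeBelow-/ a≡ e≤q 1≤r
        (λ y<q z≤1+r → +-mono-≤ (*-monoʳ-≤ b (s≤s⁻¹ y<q)) (*-monoʳ-≤ c z≤1+r)) below-e)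
      where
      open ≤-Reasoning
      regroup : ∀ q → q + q * (1 + r) ≡ q * r + 2 * q
      regroup q = solve (q ∷ r ∷ [])
      qr≤a : q * r ≤ a
      qr≤a = begin
        q * r     ≡⟨ *-comm q r ⟩
        r * q     ≤⟨ m≤m+n (r * q) e ⟩
        r * q + e ≡⟨ a≡ ⟨
        a         ∎

      below-e : ∀ {y z} → y < e → z ≤ 2 + r → b * y + c * z ≤ b * q′ + c * (1 + r)
      below-e {y} {z} y<e z≤2+r = +-cancelˡ-≤ b _ _ (begin
        b + (b * y + c * z)         ≡⟨ solve (b ∷ y ∷ c ∷ z ∷ []) ⟩
        suc y * b + c * z           ≤⟨ +-mono-≤ (*-monoˡ-≤ b y<e) (*-monoʳ-≤ c z≤2+r) ⟩
        e * b + c * (2 + r)         ≤⟨ +-monoˡ-≤ (c * (2 + r)) eb≤sa ⟩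
        s * a + c * (2 + r)         ≡⟨ solve (s ∷ a ∷ c ∷ r ∷ []) ⟩
        (c + s * a) + c * (1 + r)   ≡⟨ cong (_+ c * (1 + r)) bq≡c+sa ⟨
        b * suc q′ + c * (1 + r)    ≡⟨ solve (b ∷ q′ ∷ c ∷ r ∷ []) ⟩
        b + (b * q′ + c * (1 + r))  ∎)

  -- Fibonacci and Lucas identities and inequalities

  F-mono-suc : ∀ n → F n ≤ F (suc n)
  F-mono-suc zero    = z≤n
  F-mono-suc (suc n) = m≤m+n (F (suc n)) (F n)

  F[1+n]≤2F : ∀ {n} → 1 ≤ n → F (1 + n) ≤ 2 * F n
  F[1+n]≤2F {suc n} _ = +-monoʳ-≤ (F (1 + n)) (≤-trans (F-mono-suc n) (≤-reflexive (sym (+-identityʳ (F (1 + n))))))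

  F-mono : ∀ {m n} → m ≤ n → F m ≤ F n
  F-mono m≤n = go (≤⇒≤′ m≤n)
    where
    go : ∀ {m n} → m ≤′ n → F m ≤ F n
    go ≤′-refl          = ≤-refl
    go (≤′-step {n} m≤n) = ≤-trans (go m≤n) (F-mono-suc n)

  1≤F : ∀ {n} → 1 ≤ n → 1 ≤ F n
  1≤F = F-mono

  L≡F+F : ∀ n → L (1 + n) ≡ F n + F (2 + n)
  L≡F+F zero          = refl
  L≡F+F (suc zero)    = refl
  L≡F+F (suc (suc n)) = trans (cong₂ _+_ (L≡F+F (suc n)) (L≡F+F n)) (regroup (F n) (F (suc n)))
    where
    regroup : ∀ f g → g + (g + f + g) + (f + (g + f)) ≡ g + f + (g + f + g + (g + f))
    regroup = solve-∀

  L≡F+3F : ∀ n → L (2 + n) ≡ F n + 3 * F (1 + n)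
  L≡F+3F n = trans (L≡F+F (1 + n)) (regroup (F n) (F (1 + n)))
    where
    regroup : ∀ f g → g + (g + f + g) ≡ f + 3 * g
    regroup = solve-∀

  L≤L-suc : ∀ n → L (1 + n) ≤ L (2 + n)
  L≤L-suc n = m≤m+n (L (1 + n)) (L n)

  1≤L : ∀ n → 1 ≤ L n
  1≤L zero          = s≤s z≤n
  1≤L (suc zero)    = ≤-refl
  1≤L (suc (suc n)) = ≤-trans (1≤L (suc n)) (L≤L-suc n)

  L-coprime-suc : ∀ n → Coprime (L n) (L (1 + n))
  L-coprime-suc zero    (_ , d∣1)      = ∣1⇒≡1 d∣1
  L-coprime-suc (suc n) (d∣L₁ , d∣L₂) = L-coprime-suc n (∣m+n∣m⇒∣n d∣L₂ d∣L₁ , d∣L₁)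

  L-coprime-+2 : ∀ n → Coprime (L n) (L (2 + n))
  L-coprime-+2 n {d} (d∣L₀ , d∣L₂) =
    L-coprime-suc n (d∣L₀ , ∣m+n∣m⇒∣n (subst (d ∣_) (+-comm (L (1 + n)) (L n)) d∣L₂) d∣L₀)

  -- For fixed `n` both sides obey the Fibonacci recurrence in `k`, so two initial values suffice.
  -- With `k` shifted by two this is `c + s a = q b`.
  L-+ : ∀ k n → L (2 + k + n) + F k * L n ≡ F (2 + k) * L (2 + n)
  L-+ zero          n = trans (+-identityʳ _) (sym (+-identityʳ _))
  L-+ (suc zero)    n = regroup (L n) (L (1 + n))
    where
    regroup : ∀ l m → m + l + m + 1 * l ≡ 2 * (m + l)
    regroup = solve-∀
  L-+ (suc (suc k)) n = begin
    L (3 + k + n) + L (2 + k + n) + (F (1 + k) + F k) * L n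
      ≡⟨ regroup (L (3 + k + n)) (L (2 + k + n)) (F (1 + k)) (F k) (L n) ⟩
    (L (3 + k + n) + F (1 + k) * L n) + (L (2 + k + n) + F k * L n)
      ≡⟨ cong₂ _+_ (L-+ (suc k) n) (L-+ k n) ⟩
    F (3 + k) * L (2 + n) + F (2 + k) * L (2 + n)
      ≡⟨ *-distribʳ-+ (L (2 + n)) (F (3 + k)) (F (2 + k)) ⟨
    F (4 + k) * L (2 + n) ∎
    where
    open ≡-Reasoning
    regroup : ∀ x y u v w → x + y + (u + v) * w ≡ (x + u * w) + (y + v * w)
    regroup = solve-∀

  lucasGenerators : ∀ {i k} → 3 ≤ i → 3 ≤ k → Generators (L i) (L (i + 2)) (L (i + k)) (F k) (F (k ∸ 2))
  lucasGenerators {i@(suc (suc (suc m)))} {suc (suc (suc k))} (s≤s (s≤s (s≤s z≤n))) (s≤s (s≤s (s≤s z≤n))) =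
    subst₂ (λ x y → Generators (L i) (L x) (L y) (F (3 + k)) (F (1 + k))) (+-comm 2 i) (+-comm (3 + k) i) record
      { 1≤a     = 1≤L i
      ; 1≤s     = 1≤F {1 + k} (s≤s z≤n)
      ; 2a≤b    = +-mono-≤ (L≤L-suc (2 + m)) (≤-reflexive (+-identityʳ (L i)))
      ; 2s≤q    = +-mono-≤ (F-mono-suc (1 + k)) (≤-reflexive (+-identityʳ (F (1 + k))))
      ; coprime = L-coprime-+2 i
      ; c+sa≡qb = L-+ (1 + k) i
      }

  -- For `k = i + 1` this reads `q + s = a`. The next two identities give the excess `x` in
  -- `q = a + x` for `k = i + 2` and `k = i + 3`.
  F[1+i]+F[i∸1]≡L : ∀ {i} → 3 ≤ i → F (1 + i) + F (i ∸ 1) ≡ L i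
  F[1+i]+F[i∸1]≡L {suc i} (s≤s _) = trans (+-comm (F (2 + i)) (F i)) (sym (L≡F+F i))

  F[2+i]≡L+F[i∸2] : ∀ {i} → 3 ≤ i → F (2 + i) ≡ L i + F (i ∸ 2)
  F[2+i]≡L+F[i∸2] {suc (suc n)} (s≤s (s≤s _)) = trans (regroup (F n) (F (1 + n))) (cong (_+ F n) (sym (L≡F+3F n)))
    where
    regroup : ∀ f g → g + f + g + (g + f) ≡ f + 3 * g + f
    regroup = solve-∀

  F[3+i]≡L+2F : ∀ {i} → 3 ≤ i → F (3 + i) ≡ L i + 2 * F i
  F[3+i]≡L+2F {suc (suc n)} (s≤s (s≤s _)) = trans (regroup (F n) (F (1 + n))) (cong (_+ 2 * F (2 + n)) (sym (L≡F+3F n)))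
    where
    regroup : ∀ f g → g + f + g + (g + f) + (g + f + g) ≡ f + 3 * g + 2 * (g + f)
    regroup = solve-∀

  L≤F[2+i] : ∀ {i} → 3 ≤ i → L i ≤ F (2 + i)
  L≤F[2+i] {i} 3≤i = ≤-by (F (i ∸ 2)) (sym (F[2+i]≡L+F[i∸2] 3≤i))

  F[3+i]≤2L : ∀ {i} → 3 ≤ i → F (3 + i) ≤ 2 * L i
  F[3+i]≤2L {suc (suc n)} (s≤s (s≤s _)) = begin
    F (5 + n)                               ≡⟨ regroup (F n) (F (1 + n)) ⟩
    2 * F n + 5 * F (1 + n) + F n           ≤⟨ +-monoʳ-≤ (2 * F n + 5 * F (1 + n)) (F-mono-suc n) ⟩
    2 * F n + 5 * F (1 + n) + F (1 + n)     ≡⟨ regroup′ (F n) (F (1 + n)) ⟩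
    2 * (F n + 3 * F (1 + n))               ≡⟨ cong (2 *_) (L≡F+3F n) ⟨
    2 * L (2 + n)                           ∎
    where
    open ≤-Reasoning
    regroup : ∀ f g → g + f + g + (g + f) + (g + f + g) ≡ 2 * f + 5 * g + f
    regroup = solve-∀
    regroup′ : ∀ f g → 2 * f + 5 * g + g ≡ 2 * (f + 3 * g)
    regroup′ = solve-∀

  3L≤F[4+i] : ∀ {i} → 3 ≤ i → 3 * L i ≤ F (4 + i)
  3L≤F[4+i] {suc (suc n@(suc m))} (s≤s (s≤s (s≤s _))) = begin
    3 * L (2 + n)                                   ≡⟨ cong (3 *_) (L≡F+3F n) ⟩
    3 * (F n + 3 * F (1 + n))                       ≡⟨ regroup (F n) (F (1 + n)) ⟩
    3 * F n + 8 * F (1 + n) + F (1 + n)             ≤⟨ +-monoʳ-≤ (3 * F n + 8 * F (1 + n)) (+-monoʳ-≤ (F n) (F-mono-suc m)) ⟩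
    3 * F n + 8 * F (1 + n) + (F n + F n)           ≡⟨ regroup′ (F n) (F (1 + n)) ⟩
    F (6 + n)                                       ∎
    where
    open ≤-Reasoning
    regroup : ∀ f g → 3 * (f + 3 * g) ≡ 3 * f + 8 * g + g
    regroup = solve-∀
    regroup′ : ∀ f g → 3 * f + 8 * g + (f + f) ≡ g + f + g + (g + f) + (g + f + g) + (g + f + g + (g + f))
    regroup′ = solve-∀

  -- The difference is `F (i − 3)`. It vanishes at `i = 3`, which is the origin of the exceptional
  -- pair `(3 , 3)`.
  2F<L : ∀ {i} → 4 ≤ i → 2 * F i < L i
  2F<L {suc (suc n@(suc (suc m)))} (s≤s (s≤s (s≤s (s≤s _)))) = begin-strict
    2 * F (2 + n)                     ≡⟨ regroup (F n) (F (1 + n)) ⟩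
    F n + 2 * F (1 + n) + F n         <⟨ +-monoʳ-< (F n + 2 * F (1 + n)) f<g ⟩
    F n + 2 * F (1 + n) + F (1 + n)   ≡⟨ regroup′ (F n) (F (1 + n)) ⟩
    F n + 3 * F (1 + n)               ≡⟨ L≡F+3F n ⟨
    L (2 + n)                         ∎
    where
    open ≤-Reasoning
    f<g : F n < F (1 + n)
    f<g = ≤-trans (≤-reflexive (+-comm 1 (F n))) (+-monoʳ-≤ (F n) (1≤F {1 + m} (s≤s z≤n)))
    regroup : ∀ f g → 2 * (g + f) ≡ f + 2 * g + f
    regroup = solve-∀
    regroup′ : ∀ f g → f + 2 * g + g ≡ f + 3 * g
    regroup′ = solve-∀

  L≤2F[1+i] : ∀ {i} → 3 ≤ i → L i ≤ 2 * F (1 + i)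
  L≤2F[1+i] {i} 3≤i = begin
    L i                     ≡⟨ F[1+i]+F[i∸1]≡L 3≤i ⟨
    F (1 + i) + F (i ∸ 1)   ≤⟨ +-monoʳ-≤ (F (1 + i)) (F-mono (≤-trans (m∸n≤m i 1) (n≤1+n i))) ⟩
    F (1 + i) + F (1 + i)   ≡⟨ cong (λ u → F (1 + i) + u) (+-identityʳ (F (1 + i))) ⟨
    2 * F (1 + i)           ∎
    where open ≤-Reasoning

  2∤n⇒2∣1+n : ∀ n → 2 ∤ n → 2 ∣ suc n
  2∤n⇒2∣1+n zero          2∤0 = contradiction (2 ∣0) 2∤0
  2∤n⇒2∣1+n (suc zero)    _   = ∣-refl
  2∤n⇒2∣1+n (suc (suc n)) 2∤n = ∣m∣n⇒∣m+n ∣-refl (2∤n⇒2∣1+n n λ 2∣n → 2∤n (∣m∣n⇒∣m+n ∣-refl 2∣n))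

  2∣n⇒2∤1+n : ∀ {n} → 2 ∣ n → 2 ∤ suc n
  2∣n⇒2∤1+n {n} 2∣n 2∣1+n =
    contradiction (∣1⇒≡1 (∣m+n∣m⇒∣n (subst (2 ∣_) (+-comm 1 n) 2∣1+n) 2∣n)) λ ()

  -- Cassini's identity F n F (2 + n) − F (1 + n)² = ∓1, of which only the sign is needed.
  cassini : ∀ n → (2 ∣ n → F n * F (2 + n) ≤ F (1 + n) * F (1 + n)) ×
                  (2 ∤ n → F (1 + n) * F (1 + n) ≤ F n * F (2 + n))
  cassini zero    = (λ _ → z≤n) , λ 2∤0 → contradiction (2 ∣0) 2∤0
  cassini (suc n) =
    -- Adding `F (1 + n) * F (2 + n)` to both sides of the inequality at `n` yields the one at
    -- `1 + n` with its sides exchanged.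
    (λ 2∣1+n → begin
      F (1 + n) * F (3 + n)                             ≡⟨ odd (F n) (F (1 + n)) ⟩
      F (1 + n) * F (1 + n) + F (1 + n) * F (2 + n)     ≤⟨ +-monoˡ-≤ _ (proj₂ (cassini n) λ 2∣n → 2∣n⇒2∤1+n 2∣n 2∣1+n) ⟩
      F n * F (2 + n) + F (1 + n) * F (2 + n)           ≡⟨ even (F n) (F (1 + n)) ⟨
      F (2 + n) * F (2 + n)                             ∎) ,
    (λ 2∤1+n → begin
      F (2 + n) * F (2 + n)                             ≡⟨ even (F n) (F (1 + n)) ⟩
      F n * F (2 + n) + F (1 + n) * F (2 + n)           ≤⟨ +-monoˡ-≤ _ (proj₁ (cassini n) (decidable-stable (2 ∣? n) λ 2∤n → 2∤1+n (2∤n⇒2∣1+n n 2∤n))) ⟩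
      F (1 + n) * F (1 + n) + F (1 + n) * F (2 + n)     ≡⟨ odd (F n) (F (1 + n)) ⟨
      F (1 + n) * F (3 + n)                             ∎)
    where
    open ≤-Reasoning
    odd : ∀ f g → g * (g + f + g) ≡ g * g + g * (g + f)
    odd = solve-∀
    even : ∀ f g → (g + f) * (g + f) ≡ f * (g + f) + g * (g + f)
    even = solve-∀

  -- F i L i and F (i − 2) L (i + 2) differ by three times the two sides of Cassini's identity.
  module _ (n : ℕ) where
    private
      f = F n
      g = F (1 + n)

      FL : F (2 + n) * L (2 + n) + 3 * (f * F (2 + n)) ≡ f * L (4 + n) + 3 * (g * g)
      FL = trans (cong (λ l → F (2 + n) * l + 3 * (f * F (2 + n))) (L≡F+3F n))
             (trans (regroup f g) (cong (λ l → f * l + 3 * (g * g)) (sym (L≡F+3F (2 + n)))))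
        where
        regroup : ∀ f g → (g + f) * (f + 3 * g) + 3 * (f * (g + f)) ≡
                          f * (g + f + 3 * (g + f + g)) + 3 * (g * g)
        regroup = solve-∀

    FL≤FL : 2 ∤ n → F (2 + n) * L (2 + n) ≤ F n * L (4 + n)
    FL≤FL 2∤n = +-cancelʳ-≤ (3 * (g * g)) _ _
      (≤-trans (+-monoʳ-≤ (F (2 + n) * L (2 + n)) (*-monoʳ-≤ 3 (proj₂ (cassini n) 2∤n))) (≤-reflexive FL))

    FL≥FL : 2 ∣ n → F n * L (4 + n) ≤ F (2 + n) * L (2 + n)
    FL≥FL 2∣n = +-cancelʳ-≤ (3 * (f * F (2 + n))) _ _
      (≤-trans (+-monoʳ-≤ (F n * L (4 + n)) (*-monoʳ-≤ 3 (proj₁ (cassini n) 2∣n))) (≤-reflexive (sym FL)))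

  -- For `k = i + 2` this is `s a ≤ x b` with `x = F (i ∸ 2)`. The sign in Cassini's identity thus
  -- decides between `c` and `a b`, whence the parity split in (c).
  F[i]L≤F[i∸2]L : ∀ {i} → 3 ≤ i → 2 ∤ i → F i * L i ≤ F (i ∸ 2) * L (i + 2)
  F[i]L≤F[i∸2]L {suc (suc n)} (s≤s (s≤s _)) 2∤i =
    subst (λ x → F (2 + n) * L (2 + n) ≤ F n * L x) (+-comm 2 (2 + n))
      (FL≤FL n λ 2∣n → 2∤i (∣m∣n⇒∣m+n ∣-refl 2∣n))

  F[i∸2]L≤F[i]L : ∀ {i} → 3 ≤ i → 2 ∣ i → F (i ∸ 2) * L (i + 2) ≤ F i * L i
  F[i∸2]L≤F[i]L {suc (suc n)} (s≤s (s≤s _)) 2∣i =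
    subst (λ x → F n * L x ≤ F (2 + n) * L (2 + n)) (+-comm 2 (2 + n))
      (FL≥FL n (∣m+n∣m⇒∣n 2∣i ∣-refl))

  -- Comparison of c with a b, and division of a - 1 by q

  module _ {a b c q s x : ℕ} (G : Generators a b c q s) (q≡a+x : q ≡ a + x) where
    open Generators G

    private
      ab+xb≡c+sa : a * b + x * b ≡ c + s * a
      ab+xb≡c+sa = trans (sym (*-distribʳ-+ b a x)) (trans (cong (_* b) (sym q≡a+x)) (sym c+sa≡qb))

    ab≤c : s * a ≤ x * b → a * b ≤ c
    ab≤c sa≤xb = +-cancelʳ-≤ (s * a) _ _ (≤-trans (+-monoʳ-≤ (a * b) sa≤xb) (≤-reflexive ab+xb≡c+sa))

    c≤ab : x * b ≤ s * a → c ≤ a * b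
    c≤ab xb≤sa = +-cancelʳ-≤ (s * a) _ _ (≤-trans (≤-reflexive (sym ab+xb≡c+sa)) (+-monoʳ-≤ (a * b) xb≤sa))

  2q<a⇔2≤[a∸1]/q : ∀ {a q} .{{_ : NonZero q}} → 1 ≤ a → 2 * q < a ⇔ 2 ≤ (a ∸ 1) / q
  2q<a⇔2≤[a∸1]/q {suc a} {q} _ = mk⇔
    (λ { (s≤s 2q≤a) → subst (_≤ a / q) (m*n/n≡m 2 q) (/-monoˡ-≤ q 2q≤a) })
    (λ 2≤r → s≤s (≤-trans (*-monoˡ-≤ q 2≤r) (m/n*n≤m a q)))

  2F<L⇔ : ∀ {i k} → 3 ≤ i → 3 ≤ k → 2 * F k < L i ⇔ (k ≤ i × (i , k) ≢ (3 , 3))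
  2F<L⇔ {i} {k} 3≤i 3≤k = mk⇔ to from
    where
    to : 2 * F k < L i → k ≤ i × (i , k) ≢ (3 , 3)
    to 2F<L = ≮⇒≥ (λ i<k → <⇒≱ 2F<L (≤-trans (L≤2F[1+i] 3≤i) (*-monoʳ-≤ 2 (F-mono i<k)))) ,
              λ { refl → <-irrefl refl 2F<L }
    from : k ≤ i × (i , k) ≢ (3 , 3) → 2 * F k < L i
    from (k≤i , ≢33) with m≤n⇒m<n∨m≡n 3≤i
    ... | inj₁ 4≤i  = ≤-<-trans (*-monoʳ-≤ 2 (F-mono k≤i)) (2F<L 4≤i)
    ... | inj₂ refl = contradiction (cong (3 ,_) (≤-antisym k≤i 3≤k)) ≢33

  -- Dividing `a ∸ 1` rather than `a` puts `e` into the range from `1` to `q`, so that `e − 1` is a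
  -- legitimate coordinate `Y` even when `q` divides `a`.
  a≡[a∸1]/q*q+1+e : ∀ {a q} .{{_ : NonZero q}} → 1 ≤ a → a ≡ (a ∸ 1) / q * q + suc ((a ∸ 1) % q)
  a≡[a∸1]/q*q+1+e {suc a} {q} _ = trans (cong suc (m≡m%n+[m/n]*n a q)) (+-comm (suc (a % q)) _)

open Naturals
open import Data.Integer using (ℤ; +_; _+_; _-_; _*_; _≥_; _<_)
open import Data.Nat as ℕ using (ℕ; _∸_; _≤_; _/_)
open import Data.Nat.Divisibility using (_∣_; _∤_)
open import Data.Product using (_×_; _,_)
open import Data.Vec using ([]; _∷_)
open import Function.Bundles using (_⇔_)
open import Relation.Binary.PropositionalEquality using (_≡_; _≢_)
import Data.Integer.Properties as ℤ
open import Data.Integer.Tactic.RingSolver using (solve-∀)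
open import Data.Nat using (NonZero; suc; pred; z≤n; s≤s)
open import Data.Nat.DivMod using (_%_; m%n<n)
import Data.Nat.Properties as ℕ
open import Function.Bundles using (module Equivalence)
open import Function.Construct.Composition using (_⇔-∘_)
open import Function.Construct.Symmetry using (⇔-sym)
open import Relation.Binary.PropositionalEquality using (refl; sym; trans; cong; cong₂; subst; subst₂)

-- From natural values to the integer formulas

pos-*-comm : ∀ m n → + m * + n ≡ + (n ℕ.* m)
pos-*-comm m n = trans (sym (ℤ.pos-* m n)) (cong +_ (ℕ.*-comm m n))

y-value : ∀ {A Y} b → A ≡ + suc Y → (A - + 1) * + b ≡ + (b ℕ.* Y)
y-value {Y = Y} b refl = pos-*-comm Y b

value : ∀ {A B Y Z} b c → A ≡ + suc Y → B ≡ + (c ℕ.* Z) → (A - + 1) * + b + B ≡ + (b ℕ.* Y ℕ.+ c ℕ.* Z)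
value b c A≡ B≡ = cong₂ _+_ (y-value b A≡) B≡

value₀ : ∀ {A Y} b c → A ≡ + suc Y → (A - + 1) * + b ≡ + (b ℕ.* Y ℕ.+ c ℕ.* 0)
value₀ {Y = Y} b c A≡ = trans (y-value b A≡)
  (cong +_ (sym (trans (cong (λ u → b ℕ.* Y ℕ.+ u) (ℕ.*-zeroʳ c)) (ℕ.+-identityʳ (b ℕ.* Y)))))

pos-∸-* : ∀ {a r q e} → a ≡ r ℕ.* q ℕ.+ e → + a - + r * + q ≡ + e
pos-∸-* {r = r} {q} {e} refl = trans (cong (λ u → + (r ℕ.* q) + + e - u) (sym (ℤ.pos-* r q))) (cancel (+ (r ℕ.* q)) (+ e))
  where
  cancel : ∀ x y → x + y - x ≡ y
  cancel = solve-∀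

private
  replace : ∀ {as g X} {a : ℕ} → X ≡ g → IsFrobenius {3} 2 as (g - + a) → IsFrobenius 2 as (X - + a)
  replace refl frob = frob

theorem7 : (i k : ℕ) → 3 ≤ i → (3≤k : 3 ≤ k) →
    (i ℕ.+ 4 ≤ k →
    IsFrobenius 2 (L i ∷ L (i ℕ.+ 2) ∷ L (i ℕ.+ k) ∷ [])
    ((+ 3 * + L i - + 1) * + L (i ℕ.+ 2) - + L i))
    ×
    IsFrobenius 2 (L i ∷ L (i ℕ.+ 2) ∷ L (2 ℕ.* i ℕ.+ 3) ∷ [])
    ((+ L i - + 1) * + L (i ℕ.+ 2) + + L (2 ℕ.* i ℕ.+ 3) - + L i)
    ×
    ((2 ∤ i →
    IsFrobenius 2 (L i ∷ L (i ℕ.+ 2) ∷ L (2 ℕ.* i ℕ.+ 2) ∷ [])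
    ((+ L i - + 1) * + L (i ℕ.+ 2) + + L (2 ℕ.* i ℕ.+ 2) - + L i))
    ×
    (2 ∣ i →
    IsFrobenius 2 (L i ∷ L (i ℕ.+ 2) ∷ L (2 ℕ.* i ℕ.+ 2) ∷ [])
    ((+ 2 * + L i - + 1) * + L (i ℕ.+ 2) - + L i)))
    ×
    IsFrobenius 2 (L i ∷ L (i ℕ.+ 2) ∷ L (2 ℕ.* i ℕ.+ 1) ∷ [])
    ((+ 2 * + F (i ∸ 1) - + 1) * + L (i ℕ.+ 2) + + 2 * + L (2 ℕ.* i ℕ.+ 1) - + L i)
    ×
    (IsFrobenius 2 (L 3 ∷ L 5 ∷ L 6 ∷ []) (+ L 5 + + 3 * + L 6 - + L 3)
    × + L 5 + + 3 * + L 6 - + L 3 ≡ + 61)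
    ×
    (let r = _/_ (L i ∸ 1) (F k) {{F-nonZero 3≤k}} in
    (2 ≤ r ⇔ (k ≤ i × (i , k) ≢ (3 , 3)))
    ×
    (2 ≤ r →
    ((+ L i - + r * + F k) * + L (i ℕ.+ 2) ≥ + F (k ∸ 2) * + L i →
    IsFrobenius 2 (L i ∷ L (i ℕ.+ 2) ∷ L (i ℕ.+ k) ∷ [])
    ((+ L i - + r * + F k - + 1) * + L (i ℕ.+ 2) + (+ r + + 2) * + L (i ℕ.+ k) - + L i))
    ×
    ((+ L i - + r * + F k) * + L (i ℕ.+ 2) < + F (k ∸ 2) * + L i →
    IsFrobenius 2 (L i ∷ L (i ℕ.+ 2) ∷ L (i ℕ.+ k) ∷ [])
    ((+ F k - + 1) * + L (i ℕ.+ 2) + (+ r + + 1) * + L (i ℕ.+ k) - + L i))))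
theorem7 i k 3≤i 3≤k = partA , partB , (partC-odd , partC-even) , partD , (partE , refl) , partF-r , partF
  where
  a = L i
  b = L (i ℕ.+ 2)

  1+pred : ∀ {n} → 1 ≤ n → suc (pred n) ≡ n
  1+pred {suc n} _ = refl

  +1+pred : ∀ {X n} → 1 ≤ n → X ≡ + n → X ≡ + suc (pred n)
  +1+pred 1≤n refl = cong +_ (sym (1+pred 1≤n))

  1≤na : ∀ n → 1 ≤ suc n ℕ.* a
  1≤na n = ℕ.m≤n⇒m≤n+o (n ℕ.* a) (1≤L i)

  c*1 : ∀ c → + c ≡ + (c ℕ.* 1)
  c*1 c = cong +_ (sym (ℕ.*-identityʳ c))

  2i+ : ∀ n → i ℕ.+ (n ℕ.+ i) ≡ 2 ℕ.* i ℕ.+ n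
  2i+ n = trans (cong (λ u → i ℕ.+ u) (ℕ.+-comm n i)) (trans (sym (ℕ.+-assoc i i n))
            (cong (λ u → i ℕ.+ u ℕ.+ n) (sym (ℕ.+-identityʳ i))))

  generators-2i+ : ∀ n → Generators a b (L (2 ℕ.* i ℕ.+ n)) (F (n ℕ.+ i)) (F (n ℕ.+ i ∸ 2))
  generators-2i+ n = subst (λ j → Generators a b (L j) (F (n ℕ.+ i)) (F (n ℕ.+ i ∸ 2))) (2i+ n)
    (lucasGenerators 3≤i (ℕ.m≤n⇒m≤o+n n 3≤i))

  partA : i ℕ.+ 4 ≤ k → IsFrobenius 2 (a ∷ b ∷ L (i ℕ.+ k) ∷ []) ((+ 3 * + a - + 1) * + b - + a)
  partA i+4≤k = replace (value₀ b (L (i ℕ.+ k)) (+1+pred (1≤na 2) (sym (ℤ.pos-* 3 a))))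
    (isFrobenius-3a≤q (lucasGenerators 3≤i 3≤k) (1+pred (1≤na 2))
      (ℕ.≤-trans (3L≤F[4+i] 3≤i) (F-mono (ℕ.≤-trans (ℕ.≤-reflexive (ℕ.+-comm 4 i)) i+4≤k))))

  partB : IsFrobenius 2 (a ∷ b ∷ L (2 ℕ.* i ℕ.+ 3) ∷ []) ((+ a - + 1) * + b + + L (2 ℕ.* i ℕ.+ 3) - + a)
  partB = replace (value b (L (2 ℕ.* i ℕ.+ 3)) (+1+pred (1≤L i) refl) (c*1 (L (2 ℕ.* i ℕ.+ 3))))
    (isFrobenius-ab≤c G (1+pred (1≤L i)) (ℕ.≤-trans (L≤F[2+i] 3≤i) (F-mono-suc (2 ℕ.+ i))) (F[3+i]≤2L 3≤i)
      -- Here `s = F (1 + i)` and `x = 2 F i`, so `s a ≤ x b` holds factor by factor.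
      (ab≤c G (F[3+i]≡L+2F 3≤i) (ℕ.*-mono-≤ (F[1+n]≤2F (ℕ.<⇒≤ (ℕ.<⇒≤ 3≤i))) (ℕ.m+n≤o⇒m≤o a 2a≤b))))
    where
    G = generators-2i+ 3
    open Generators G using (2a≤b)

  partC-odd : 2 ∤ i → IsFrobenius 2 (a ∷ b ∷ L (2 ℕ.* i ℕ.+ 2) ∷ []) ((+ a - + 1) * + b + + L (2 ℕ.* i ℕ.+ 2) - + a)
  partC-odd 2∤i = replace (value b (L (2 ℕ.* i ℕ.+ 2)) (+1+pred (1≤L i) refl) (c*1 (L (2 ℕ.* i ℕ.+ 2))))
    (isFrobenius-ab≤c G (1+pred (1≤L i)) (L≤F[2+i] 3≤i) (ℕ.≤-trans (F-mono-suc (2 ℕ.+ i)) (F[3+i]≤2L 3≤i))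
      (ab≤c G (F[2+i]≡L+F[i∸2] 3≤i) (F[i]L≤F[i∸2]L 3≤i 2∤i)))
    where
    G = generators-2i+ 2

  partC-even : 2 ∣ i → IsFrobenius 2 (a ∷ b ∷ L (2 ℕ.* i ℕ.+ 2) ∷ []) ((+ 2 * + a - + 1) * + b - + a)
  partC-even 2∣i = replace (value₀ b (L (2 ℕ.* i ℕ.+ 2)) (+1+pred (1≤na 1) (sym (ℤ.pos-* 2 a))))
    (isFrobenius-c≤ab G (1+pred (1≤na 1)) (L≤F[2+i] 3≤i)
      (c≤ab G (F[2+i]≡L+F[i∸2] 3≤i) (F[i∸2]L≤F[i]L 3≤i 2∣i)))
    where
    G = generators-2i+ 2

  partD : IsFrobenius 2 (a ∷ b ∷ L (2 ℕ.* i ℕ.+ 1) ∷ [])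
            ((+ 2 * + F (i ∸ 1) - + 1) * + b + + 2 * + L (2 ℕ.* i ℕ.+ 1) - + a)
  partD = replace (value b c (+1+pred 1≤2s (sym (ℤ.pos-* 2 (F (i ∸ 1))))) (pos-*-comm 2 c))
    (isFrobenius-q+s≡a G (1+pred 1≤2s) (F[1+i]+F[i∸1]≡L 3≤i))
    where
    c = L (2 ℕ.* i ℕ.+ 1)
    G = generators-2i+ 1
    1≤2s = ℕ.m≤n⇒m≤n+o _ (Generators.1≤s G)

  partE : IsFrobenius 2 (L 3 ∷ L 5 ∷ L 6 ∷ []) (+ L 5 + + 3 * + L 6 - + L 3)
  -- At `(3 , 3)` one has `a = 4 = 2 q`, hence `r = 1` and `e = q = 2`. This boundary case of
  -- `2 q ≤ a` still follows the first formula of (f), although `r ≥ 2` fails.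
  partE = isFrobenius-sa≤eb (lucasGenerators {3} {3} ℕ.≤-refl ℕ.≤-refl) {1} {1} refl ℕ.≤-refl ℕ.≤-refl ℕ.≤-refl
    (s≤s (s≤s (s≤s (s≤s z≤n))))

  q = F k
  s = F (k ∸ 2)
  c = L (i ℕ.+ k)

  instance
    q≢0 : NonZero q
    q≢0 = F-nonZero 3≤k

  r = (a ∸ 1) / q

  partF-r : 2 ≤ r ⇔ (k ≤ i × (i , k) ≢ (3 , 3))
  partF-r = 2F<L⇔ 3≤i 3≤k ⇔-∘ ⇔-sym (2q<a⇔2≤[a∸1]/q (1≤L i))

  partF : 2 ≤ r →
    ((+ a - + r * + q) * + b ≥ + s * + a →
      IsFrobenius 2 (a ∷ b ∷ c ∷ []) ((+ a - + r * + q - + 1) * + b + (+ r + + 2) * + c - + a))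
    ×
    ((+ a - + r * + q) * + b < + s * + a →
      IsFrobenius 2 (a ∷ b ∷ c ∷ []) ((+ q - + 1) * + b + (+ r + + 1) * + c - + a))
  partF 2≤r =
    (λ eb≥sa → replace (value b c (pos-∸-* {r = r} a≡) (z-value 2))
      (isFrobenius-sa≤eb G a≡ e≤q 1≤r 2q≤a
        (ℤ.drop‿+≤+ (subst₂ (λ m n → n ≥ m) (sym (ℤ.pos-* s a)) eb≡ eb≥sa)))) ,
    (λ eb<sa → replace (value b c (+1+pred (1≤q G) refl) (z-value 1))
      (isFrobenius-eb≤sa G (1+pred (1≤q G)) a≡ e≤q 1≤r 2q≤a
        (ℕ.<⇒≤ (ℤ.drop‿+<+ (subst₂ _<_ eb≡ (sym (ℤ.pos-* s a)) eb<sa)))))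
    where
    G = lucasGenerators 3≤i 3≤k
    a≡ = a≡[a∸1]/q*q+1+e {q = q} (1≤L i)
    e≤q = m%n<n (a ∸ 1) q
    1≤r = ℕ.<⇒≤ 2≤r
    2q≤a = ℕ.<⇒≤ (Equivalence.from (2q<a⇔2≤[a∸1]/q (1≤L i)) 2≤r)
    eb≡ : (+ a - + r * + q) * + b ≡ + (suc ((a ∸ 1) % q) ℕ.* b)
    eb≡ = trans (cong (_* + b) (pos-∸-* {r = r} a≡)) (sym (ℤ.pos-* (suc ((a ∸ 1) % q)) b))
    z-value : ∀ n → (+ r + + n) * + c ≡ + (c ℕ.* (n ℕ.+ r))
    z-value n = trans (pos-*-comm (r ℕ.+ n) c) (cong (λ u → + (c ℕ.* u)) (ℕ.+-comm r n))
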